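{- Let $G$ be a finite, simple, connected $3$-$\gamma_{c}$-critical graph with $\kappa(G) + 1 \leq \alpha(G)$. Then $G \in \mathcal{G}_{2}(3,3)$ or $\kappa(G) = \delta(G)$.
   Context: All graphs are finite, simple and connected. A set $D \subseteq V(G)$ is a connected dominating set of $G$ if every vertex of $G$ is in $D$ or adjacent to a vertex of $D$, and $G[D]$ is connected; $\gamma_{c}(G)$ is the minimum size of such a set. For non-adjacent $u,v$, $G+uv$ is $G$ with edge $uv$ added. $G$ is $3$-$\gamma_{c}$-critical if $\gamma_{c}(G)=3$ and $\gamma_{c}(G+uv)<3$ for every pair of non-adjacent vertices $u,v$. $\alpha(G)$ is the independence number, $\delta(G)$ the minimum degree, $\kappa(G)$ the connectivity (minimum size of a vertex set whose removal disconnects $G$). The class $\mathcal{G}_{2}(3,3)$: take integers $j_1, j_2 \geq 3$, pairwise disjoint vertex sets $J_1, J_2$ with $|J_1| = j_1$, $|J_2| = j_2$, two distinct vertices $u_1, u_2 \in J_2$, and three further vertices $w, w_1, v_1$. Form the graph on $J_1 \cup J_2 \cup \{w, w_1, v_1\}$ whose edges are exactly: all edges inside $J_1$ (a clique), all edges inside $J_2$ (a clique), $v_1$ joined to every vertex of $J_1$, $w_1$ joined to every vertex of $J_1 \cup (J_2 \setminus \{u_1\}) \cup \{w\}$, and $w$ joined to every vertex of $J_1 \cup (J_2 \setminus \{u_2\}) \cup \{w_1\}$. $\mathcal{G}_{2}(3,3)$ is the class of all graphs (up to isomorphism) obtained this way. -}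

module Defs where

open import Data.Nat using (ℕ; _≤_; _<_; _∸_)
open import Data.Bool using (Bool; true; false; _∨_; _∧_; T)
open import Data.Fin using (Fin; _≟_)
open import Data.Fin.Subset using (Subset; _∈_; _∉_; ∣_∣; ∁) renaming (⊤ to Full)
open import Data.Vec using (tabulate)
open import Data.Product using (Σ; Σ-syntax; _×_)
open import Data.Sum using (_⊎_)
open import Data.Unit using (⊤)
open import Data.Empty using (⊥)
open import Relation.Nullary using (¬_)
open import Relation.Nullary.Decidable using (⌊_⌋)
open import Relation.Binary.PropositionalEquality using (_≡_; _≢_)
open import Function.Bundles using (_↔_; _⇔_; Inverse)

record Graph : Set where
  field
    n      : ℕ
    adj    : Fin n → Fin n → Bool
    sym    : ∀ x y → adj x y ≡ adj y x
    irrefl : ∀ x → adj x x ≡ false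

module _ {n : ℕ} (adj : Fin n → Fin n → Bool) where

  Adj : Fin n → Fin n → Set
  Adj x y = T (adj x y)

  data PathIn (D : Subset n) : Fin n → Fin n → Set where
    stop : ∀ {x} → x ∈ D → PathIn D x x
    step : ∀ {x y z} → x ∈ D → Adj x y → PathIn D y z → PathIn D x z

  ConnectedIn : Subset n → Set
  ConnectedIn D = ∀ x y → x ∈ D → y ∈ D → PathIn D x y

  Connected : Set
  Connected = ConnectedIn Full

  Dominating : Subset n → Set
  Dominating D = ∀ v → v ∈ D ⊎ Σ[ u ∈ Fin n ] (u ∈ D × Adj v u)

  IsCDS : Subset n → Set
  IsCDS D = Dominating D × ConnectedIn D

  ConnDomNum : ℕ → Set
  ConnDomNum k = (Σ[ D ∈ Subset n ] (IsCDS D × ∣ D ∣ ≡ k))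
               × (∀ D → IsCDS D → k ≤ ∣ D ∣)

  Independent : Subset n → Set
  Independent S = ∀ x y → x ∈ S → y ∈ S → ¬ Adj x y

  IndepNum : ℕ → Set
  IndepNum k = (Σ[ S ∈ Subset n ] (Independent S × ∣ S ∣ ≡ k))
             × (∀ S → Independent S → ∣ S ∣ ≤ k)

  neighbourhood : Fin n → Subset n
  neighbourhood v = tabulate (adj v)

  degree : Fin n → ℕ
  degree v = ∣ neighbourhood v ∣

  MinDeg : ℕ → Set
  MinDeg k = (Σ[ v ∈ Fin n ] degree v ≡ k) × (∀ v → k ≤ degree v)

  Separating : Subset n → Set
  Separating S = Σ[ x ∈ Fin n ] Σ[ y ∈ Fin n ]
                   (x ∉ S × y ∉ S × ¬ PathIn (∁ S) x y)

  -- κ(G) = k  (minimum size of a separating set; n - 1 if there is none,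
  -- i.e. for complete graphs)
  ConnectivityNum : ℕ → Set
  ConnectivityNum k =
      ((Σ[ S ∈ Subset n ] (Separating S × ∣ S ∣ ≡ k))
        × (∀ S → Separating S → k ≤ ∣ S ∣))
    ⊎ ((∀ S → ¬ Separating S) × k ≡ n ∸ 1)

  addEdge : Fin n → Fin n → Fin n → Fin n → Bool
  addEdge u v x y = adj x y ∨ (⌊ x ≟ u ⌋ ∧ ⌊ y ≟ v ⌋) ∨ (⌊ x ≟ v ⌋ ∧ ⌊ y ≟ u ⌋)

Critical3 : {n : ℕ} → (Fin n → Fin n → Bool) → Set
Critical3 {n} adj =
  ConnDomNum adj 3 ×
  (∀ u v → u ≢ v → ¬ Adj adj u v →
     Σ[ k ∈ ℕ ] (ConnDomNum (addEdge adj u v) k × k < 3))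

data V233 (j₁ j₂ : ℕ) : Set where
  J₁ : Fin j₁ → V233 j₁ j₂
  J₂ : Fin j₂ → V233 j₁ j₂
  w w₁ v₁ : V233 j₁ j₂

E233 : ∀ {j₁ j₂} (u₁ u₂ : Fin j₂) → V233 j₁ j₂ → V233 j₁ j₂ → Set
E233 u₁ u₂ (J₁ a) (J₁ b) = a ≢ b
E233 u₁ u₂ (J₂ a) (J₂ b) = a ≢ b
E233 u₁ u₂ v₁ (J₁ _) = ⊤
E233 u₁ u₂ (J₁ _) v₁ = ⊤
E233 u₁ u₂ w₁ (J₁ _) = ⊤
E233 u₁ u₂ (J₁ _) w₁ = ⊤
E233 u₁ u₂ w₁ (J₂ b) = b ≢ u₁
E233 u₁ u₂ (J₂ b) w₁ = b ≢ u₁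
E233 u₁ u₂ w₁ w = ⊤
E233 u₁ u₂ w w₁ = ⊤
E233 u₁ u₂ w (J₁ _) = ⊤
E233 u₁ u₂ (J₁ _) w = ⊤
E233 u₁ u₂ w (J₂ b) = b ≢ u₂
E233 u₁ u₂ (J₂ b) w = b ≢ u₂
E233 u₁ u₂ _ _ = ⊥

InG233 : Graph → Set
InG233 G = Σ[ j₁ ∈ ℕ ] Σ[ j₂ ∈ ℕ ] Σ[ u₁ ∈ Fin j₂ ] Σ[ u₂ ∈ Fin j₂ ]
  (3 ≤ j₁ × 3 ≤ j₂ × u₁ ≢ u₂ ×
   Σ[ φ ∈ (Fin (Graph.n G) ↔ V233 j₁ j₂) ]
     (∀ x y → Adj (Graph.adj G) x y ⇔
                E233 u₁ u₂ (Inverse.to φ x) (Inverse.to φ y)))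

{-# OPTIONS --safe #-}
-- Suppose κ < δ, let S be a minimum cut and A, B the two sides of V ∖ S, and let I be independent
-- with |I| > |S|. Adding an edge uv to a 3-γc-critical graph produces either a dominating pair
-- {u,v}, or an arc u → v through y: y is adjacent to u and {u,y} dominates everything but v (or the
-- same with u and v exchanged). An arc starting outside S goes through a vertex of S, because the
-- other side must be dominated. If |S| ≥ 2, every two vertices of I are joined by an arc, whose
-- middle vertex misses exactly one vertex of I, namely the head; so the heads of the arcs leaving
-- I ∖ S inject into S ∖ I. As |I ∖ S| > |S ∖ I|, some x₀ ∈ I ∖ S (say in A) is not such a head, and the
-- count is then tight: every vertex of S ∖ I is the middle of exactly one arc x₀ → a with a ∈ I ∖ S.
-- This forces I ∖ S ⊆ B ∪ {x₀}. If |I ∖ S| ≠ 2 two adjacent vertices dominate the graph, and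
-- if I ∖ S = {x₀,a} all adjacencies are determined and the graph belongs to the exceptional family.
-- A cut of size at most 1 is excluded directly.
module Submission where

open import Defs
open import Data.Bool using (Bool; T; _∨_; _∧_)
open import Data.Bool.Properties using (T?; T-∨; T-∧; T-≡; ∨-comm; ∧-comm)
open import Data.Empty using (⊥; ⊥-elim)
open import Data.Fin using (Fin; zero; suc; _≟_)
open import Data.Fin.Properties using (any?; all?; ¬∀⟶∃¬; suc-injective)
open import Data.Fin.Subset using (Subset; _∈_; _∉_; _⊆_; ∣_∣; ⁅_⁆; _∪_; _-_; ∁; inside; outside)
  renaming (⊤ to Full; ⊥ to ⊥ˢ)
open import Data.Fin.Subset.Properties
open import Data.Nat using (ℕ; zero; suc; _+_; _≤_; _<_; z≤n; s≤s; _≤?_)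
import Data.Nat as ℕ
open import Data.Nat.Properties using (≤-refl; ≤-reflexive; ≤-trans; <-≤-trans; ≤-<-trans; <⇒≱;
  ≤-pred; +-mono-≤; +-suc; m≤n⇒m≤1+n; ≰⇒>; ≤∧≢⇒<)
open import Data.Product using (Σ-syntax; ∃-syntax; _×_; _,_; proj₁; proj₂)
open import Data.Sum using (_⊎_; inj₁; inj₂; [_,_]) renaming (swap to ⊎-swap; map to ⊎-map)
open import Data.Unit using (⊤; tt)
open import Data.Vec using ([]; _∷_; here; there; tabulate)
open import Data.Vec.Properties using ([]=⇒lookup; lookup⇒[]=; lookup∘tabulate)
open import Function using (_∘_; id; case_of_)
open import Function.Bundles using (_⇔_; _↔_; mk⇔; mk↔ₛ′; Inverse; Equivalence)
open import Relation.Nullary using (¬_; Dec; yes; no; ¬?; contradiction)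
open import Relation.Nullary.Decidable using (⌊_⌋; toWitness; decidable-stable; _×-dec_; _⊎-dec_;
  _→-dec_; ¬¬-excluded-middle; does; dec-true)
open import Relation.Binary.PropositionalEquality using (_≡_; _≢_; refl; sym; trans; cong; cong₂;
  subst; subst₂; ≢-sym)

-- Finite subsets: cardinality, pigeonhole and enumeration.

≢-by-∈ : ∀ {n} {p : Subset n} {x y} → x ∈ p → y ∉ p → x ≢ y
≢-by-∈ x∈p y∉p refl = y∉p x∈p

∣p∪q∣≤∣p∣+∣q∣ : ∀ {n} (p q : Subset n) → ∣ p ∪ q ∣ ≤ ∣ p ∣ + ∣ q ∣
∣p∪q∣≤∣p∣+∣q∣ []            []            = z≤n
∣p∪q∣≤∣p∣+∣q∣ (inside  ∷ p) (inside  ∷ q) = s≤s (≤-trans (m≤n⇒m≤1+n (∣p∪q∣≤∣p∣+∣q∣ p q)) (≤-reflexive (sym (+-suc ∣ p ∣ ∣ q ∣))))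
∣p∪q∣≤∣p∣+∣q∣ (inside  ∷ p) (outside ∷ q) = s≤s (∣p∪q∣≤∣p∣+∣q∣ p q)
∣p∪q∣≤∣p∣+∣q∣ (outside ∷ p) (inside  ∷ q) = ≤-trans (s≤s (∣p∪q∣≤∣p∣+∣q∣ p q)) (≤-reflexive (sym (+-suc ∣ p ∣ ∣ q ∣)))
∣p∪q∣≤∣p∣+∣q∣ (outside ∷ p) (outside ∷ q) = ∣p∪q∣≤∣p∣+∣q∣ p q

∣⁅x⁆∪⁅y⁆∣≤2 : ∀ {n} (x y : Fin n) → ∣ ⁅ x ⁆ ∪ ⁅ y ⁆ ∣ ≤ 2
∣⁅x⁆∪⁅y⁆∣≤2 x y = ≤-trans (∣p∪q∣≤∣p∣+∣q∣ ⁅ x ⁆ ⁅ y ⁆)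
  (+-mono-≤ (≤-reflexive (∣⁅x⁆∣≡1 x)) (≤-reflexive (∣⁅x⁆∣≡1 y)))

x∈⁅x⁆∪⁅y⁆ : ∀ {n} (x y : Fin n) → x ∈ ⁅ x ⁆ ∪ ⁅ y ⁆
x∈⁅x⁆∪⁅y⁆ x y = x∈p∪q⁺ (inj₁ (x∈⁅x⁆ x))

y∈⁅x⁆∪⁅y⁆ : ∀ {n} (x y : Fin n) → y ∈ ⁅ x ⁆ ∪ ⁅ y ⁆
y∈⁅x⁆∪⁅y⁆ x y = x∈p∪q⁺ {p = ⁅ x ⁆} (inj₂ (x∈⁅x⁆ y))

x∈⁅y⁆∪⁅z⁆⁻ : ∀ {n} {x : Fin n} y z → x ∈ ⁅ y ⁆ ∪ ⁅ z ⁆ → x ≡ y ⊎ x ≡ z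
x∈⁅y⁆∪⁅z⁆⁻ y z = ⊎-map (x∈⁅y⁆⇒x≡y y) (x∈⁅y⁆⇒x≡y z) ∘ x∈p∪q⁻ ⁅ y ⁆ ⁅ z ⁆

x∈p-y⁻ : ∀ {n} {x : Fin n} p y → x ∈ p - y → x ∈ p × x ≢ y
x∈p-y⁻ (inside ∷ p) zero    (there x∈p-y) = there (subst (_ ∈_) (p─⊥≡p p) x∈p-y) , λ ()
x∈p-y⁻ (outside ∷ p) zero    (there x∈p-y) = there (subst (_ ∈_) (p─⊥≡p p) x∈p-y) , λ ()
x∈p-y⁻ (inside ∷ p) (suc y) here          = here , λ ()
x∈p-y⁻ (inside ∷ p) (suc y) (there x∈p-y) with x∈p-y⁻ p y x∈p-y
... | x∈p , x≢y = there x∈p , λ { refl → x≢y refl }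
x∈p-y⁻ (outside ∷ p) (suc y) (there x∈p-y) with x∈p-y⁻ p y x∈p-y
... | x∈p , x≢y = there x∈p , λ { refl → x≢y refl }

x∈p⇒0<∣p∣ : ∀ {n} {p : Subset n} {x} → x ∈ p → 0 < ∣ p ∣
x∈p⇒0<∣p∣ x∈p = ≤-<-trans z≤n (x∈p⇒∣p-x∣<∣p∣ x∈p)

∣p∣<∣q∣⇒∃∈q∉p : ∀ {n} (p q : Subset n) → ∣ p ∣ < ∣ q ∣ → ∃[ x ] (x ∈ q × x ∉ p)
∣p∣<∣q∣⇒∃∈q∉p p q lt with any? (λ x → (x ∈? q) ×-dec ¬? (x ∈? p))
... | yes found = found
... | no none   = contradiction (p⊆q⇒∣p∣≤∣q∣ q⊆p) (<⇒≱ lt)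
  where
  q⊆p : q ⊆ p
  q⊆p {x} x∈q = decidable-stable (x ∈? p) (λ x∉p → none (x , x∈q , x∉p))

-- Induction on `p`: the partner of its first element is deleted from `q`, and injectivity shows
-- that no other element is related to it. A relation is used because partners come out of case
-- analyses.
pigeonhole : ∀ {n m} (p : Subset n) (q : Subset m) (R : Fin n → Fin m → Set) →
  (∀ {x} → x ∈ p → ∃[ y ] (y ∈ q × R x y)) →
  (∀ {x x′ y} → R x y → R x′ y → x ≡ x′) → ∣ p ∣ ≤ ∣ q ∣
pigeonhole []            q R total inj = z≤n
pigeonhole (outside ∷ p) q R total inj =
  pigeonhole p q (R ∘ suc) (total ∘ there) (λ r r′ → suc-injective (inj r r′))
pigeonhole (inside ∷ p) q R total inj with total here
... | y₀ , y₀∈q , r₀ = ≤-trans (s≤s (pigeonhole p (q - y₀) (R ∘ suc) total′ inj′)) (x∈p⇒∣p-x∣<∣p∣ y₀∈q)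
  where
  inj′ : ∀ {x x′ y} → R (suc x) y → R (suc x′) y → x ≡ x′
  inj′ r r′ with inj r r′
  ... | refl = refl
  total′ : ∀ {x} → x ∈ p → ∃[ y ] (y ∈ q - y₀ × R (suc x) y)
  total′ {x} x∈p with total (there x∈p)
  ... | y , y∈q , r = y , x∈p∧x≢y⇒x∈p-y y∈q y≢y₀ , r
    where
    y≢y₀ : y ≢ y₀
    y≢y₀ refl with inj r r₀
    ... | ()

-- `y` may coincide with `x`; this happens when `p` is a singleton.
∣p∣≤2⇒pair : ∀ {n} {p : Subset n} {x} → ∣ p ∣ ≤ 2 → x ∈ p →
  ∃[ y ] (y ∈ p × (∀ {z} → z ∈ p → z ≡ x ⊎ z ≡ y))
∣p∣≤2⇒pair {p = p} {x} ∣p∣≤2 x∈p with any? (λ y → (y ∈? p) ×-dec ¬? (y ≟ x))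
... | no none = x , x∈p , λ {z} z∈p →
  inj₁ (decidable-stable (z ≟ x) (λ z≢x → none (z , z∈p , z≢x)))
... | yes (y , y∈p , y≢x) = y , y∈p , only
  where
  ∣p-x-y∣<1 : ∣ p - x - y ∣ < 1
  ∣p-x-y∣<1 = <-≤-trans (x∈p⇒∣p-x∣<∣p∣ (x∈p∧x≢y⇒x∈p-y y∈p y≢x))
                (≤-pred (≤-trans (x∈p⇒∣p-x∣<∣p∣ x∈p) ∣p∣≤2))
  only : ∀ {z} → z ∈ p → z ≡ x ⊎ z ≡ y
  only {z} z∈p with z ≟ x | z ≟ y
  ... | yes z≡x | _       = inj₁ z≡x
  ... | no _    | yes z≡y = inj₂ z≡y
  ... | no z≢x  | no z≢y  = contradiction ∣p-x-y∣<1
    (<⇒≱ (s≤s (x∈p⇒0<∣p∣ (x∈p∧x≢y⇒x∈p-y (x∈p∧x≢y⇒x∈p-y z∈p z≢x) z≢y))))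

-- The increasing enumeration of `p`; it later indexes the two cliques of the exceptional family.
element : ∀ {n} (p : Subset n) → Fin ∣ p ∣ → Fin n
element (inside  ∷ p) zero    = zero
element (inside  ∷ p) (suc i) = suc (element p i)
element (outside ∷ p) i       = suc (element p i)

element∈ : ∀ {n} (p : Subset n) i → element p i ∈ p
element∈ (inside  ∷ p) zero    = here
element∈ (inside  ∷ p) (suc i) = there (element∈ p i)
element∈ (outside ∷ p) i       = there (element∈ p i)

element-injective : ∀ {n} (p : Subset n) {i j} → element p i ≡ element p j → i ≡ j
element-injective (inside  ∷ p) {zero}  {zero}  eq = refl
element-injective (inside  ∷ p) {suc i} {suc j} eq = cong suc (element-injective p (suc-injective eq))
element-injective (outside ∷ p) {i}     {j}     eq = element-injective p (suc-injective eq)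

element-surjective : ∀ {n} {p : Subset n} {x} → x ∈ p → ∃[ i ] element p i ≡ x
element-surjective here = zero , refl
element-surjective {p = inside ∷ p} (there x∈p) with element-surjective x∈p
... | i , refl = suc i , refl
element-surjective {p = outside ∷ p} (there x∈p) with element-surjective x∈p
... | i , refl = i , refl

-- Double-negation shift over a finite index set: towards a contradiction, finitely many
-- propositions may be assumed decided all at once.
¬¬-dec-Fin : ∀ {n} (P : Fin n → Set) → ¬ ¬ (∀ i → Dec (P i))
¬¬-dec-Fin {zero}  P k = k λ ()
¬¬-dec-Fin {suc n} P k = ¬¬-excluded-middle λ d → ¬¬-dec-Fin (P ∘ suc) λ ds →
  k λ { zero → d ; (suc i) → ds i }

⌊⌋-elim : ∀ {n} {x y u v : Fin n} → T (⌊ x ≟ u ⌋ ∧ ⌊ y ≟ v ⌋) → x ≡ u × y ≡ v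
⌊⌋-elim {x = x} {y} {u} {v} t with Equivalence.to (T-∧ {⌊ x ≟ u ⌋}) t
... | p , q = toWitness p , toWitness q

-- Closed neighbourhoods, dominating pairs and arcs.

module Covering {n : ℕ} (_~_ : Fin n → Fin n → Set) where

  -- Membership of `s` in the closed neighbourhood of `x`. As a condition on a pair it means equal
  -- or adjacent, so connected dominating sets of one and of two vertices are treated together.
  Covers : Fin n → Fin n → Set
  Covers x s = s ≡ x ⊎ x ~ s

  CoveringPair : Fin n → Fin n → Set
  CoveringPair x y = ∀ s → Covers x s ⊎ Covers y s

  -- [u,y] → v in the literature on critical graphs.
  record Arc (u v y : Fin n) : Set where
    field
      u~y    : u ~ y
      v≢y    : v ≢ y
      y≁v    : ¬ (y ~ v)
      covers : ∀ s → s ≢ v → Covers u s ⊎ Covers y s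

Adj-sym : ∀ {n} (adj : Fin n → Fin n → Bool) → (∀ x y → adj x y ≡ adj y x) →
  ∀ {x y} → Adj adj x y → Adj adj y x
Adj-sym adj adj-sym {x} {y} = subst T (adj-sym x y)

module _ {n : ℕ} (adj : Fin n → Fin n → Bool) (adj-sym : ∀ x y → adj x y ≡ adj y x) where
  open Covering (Adj adj)

  private
    ~-sym : ∀ {x y} → Adj adj x y → Adj adj y x
    ~-sym = Adj-sym adj adj-sym

  covers-pair⇒CDS : ∀ {x y} → Covers x y → CoveringPair x y → IsCDS adj (⁅ x ⁆ ∪ ⁅ y ⁆)
  covers-pair⇒CDS {x} {y} x-y pair = dominating , connected
    where
    x∈ : x ∈ ⁅ x ⁆ ∪ ⁅ y ⁆
    x∈ = x∈⁅x⁆∪⁅y⁆ x y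
    y∈ : y ∈ ⁅ x ⁆ ∪ ⁅ y ⁆
    y∈ = y∈⁅x⁆∪⁅y⁆ x y
    dominating : Dominating adj (⁅ x ⁆ ∪ ⁅ y ⁆)
    dominating s with pair s
    ... | inj₁ (inj₁ refl) = inj₁ x∈
    ... | inj₁ (inj₂ x~s)  = inj₂ (x , x∈ , ~-sym x~s)
    ... | inj₂ (inj₁ refl) = inj₁ y∈
    ... | inj₂ (inj₂ y~s)  = inj₂ (y , y∈ , ~-sym y~s)
    x⟶y : Covers x y → PathIn adj (⁅ x ⁆ ∪ ⁅ y ⁆) x y
    x⟶y (inj₁ refl) = stop x∈
    x⟶y (inj₂ x~y)  = step x∈ x~y (stop y∈)
    y⟶x : Covers x y → PathIn adj (⁅ x ⁆ ∪ ⁅ y ⁆) y x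
    y⟶x (inj₁ refl) = stop x∈
    y⟶x (inj₂ x~y)  = step y∈ (~-sym x~y) (stop x∈)
    connected : ConnectedIn adj (⁅ x ⁆ ∪ ⁅ y ⁆)
    connected a b a∈ b∈ with x∈⁅y⁆∪⁅z⁆⁻ x y a∈ | x∈⁅y⁆∪⁅z⁆⁻ x y b∈
    ... | inj₁ refl | inj₁ refl = stop x∈
    ... | inj₁ refl | inj₂ refl = x⟶y x-y
    ... | inj₂ refl | inj₁ refl = y⟶x x-y
    ... | inj₂ refl | inj₂ refl = stop y∈

  -- `v` serves to make `D` nonempty. As `D` has no vertices besides `x` and `y`, a path in `D` from
  -- `x` to `y` must use an edge between them, unless they coincide.
  small-CDS⇒pair : ∀ {D} (v : Fin n) → IsCDS adj D → ∣ D ∣ ≤ 2 →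
    ∃[ x ] ∃[ y ] (Covers x y × CoveringPair x y)
  small-CDS⇒pair {D} v (dominating , connected) ∣D∣≤2 with nonempty
    where
    nonempty : ∃[ x ] x ∈ D
    nonempty with dominating v
    ... | inj₁ v∈D           = v , v∈D
    ... | inj₂ (u , u∈D , _) = u , u∈D
  ... | x , x∈D with ∣p∣≤2⇒pair ∣D∣≤2 x∈D
  ... | y , y∈D , only = x , y , linked , pair
    where
    head∈ : ∀ {a b} → PathIn adj D a b → a ∈ D
    head∈ (stop a∈)     = a∈
    head∈ (step a∈ _ _) = a∈
    link : ∀ {b} → PathIn adj D x b → b ≡ y → Covers x y
    link (stop _) refl = inj₁ refl
    link (step _ x~a path) b≡y with only (head∈ path)
    ... | inj₁ refl = link path b≡y
    ... | inj₂ refl = inj₂ x~a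
    linked : Covers x y
    linked = link (connected x y x∈D y∈D) refl
    pair : CoveringPair x y
    pair s with dominating s
    ... | inj₁ s∈D = ⊎-map inj₁ inj₁ (only s∈D)
    ... | inj₂ (u , u∈D , s~u) with only u∈D
    ...   | inj₁ refl = inj₁ (inj₂ (~-sym s~u))
    ...   | inj₂ refl = inj₂ (inj₂ (~-sym s~u))

-- Adding an edge to a critical graph.

module _ {n : ℕ} (adj : Fin n → Fin n → Bool) (adj-sym : ∀ x y → adj x y ≡ adj y x) where
  open Covering (Adj adj)

  addEdge-elim : ∀ {u v x y} → Adj (addEdge adj u v) x y →
    Adj adj x y ⊎ (x ≡ u × y ≡ v) ⊎ (x ≡ v × y ≡ u)
  addEdge-elim {u} {v} {x} {y} t with Equivalence.to (T-∨ {adj x y}) t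
  ... | inj₁ x~y = inj₁ x~y
  ... | inj₂ t′ with Equivalence.to (T-∨ {⌊ x ≟ u ⌋ ∧ ⌊ y ≟ v ⌋}) t′
  ...   | inj₁ p = inj₂ (inj₁ (⌊⌋-elim p))
  ...   | inj₂ p = inj₂ (inj₂ (⌊⌋-elim p))

  addEdge-sym : ∀ u v x y → addEdge adj u v x y ≡ addEdge adj u v y x
  addEdge-sym u v x y = cong₂ _∨_ (adj-sym x y)
    (trans (∨-comm (⌊ x ≟ u ⌋ ∧ ⌊ y ≟ v ⌋) _)
           (cong₂ _∨_ (∧-comm ⌊ x ≟ v ⌋ _) (∧-comm ⌊ x ≟ u ⌋ _)))

  module _ (crit : Critical3 adj) where

    -- For `x ≡ y` this excludes a single dominating vertex.
    no-covering-pair : ∀ {x y} → Covers x y → ¬ CoveringPair x y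
    no-covering-pair {x} {y} x-y pair = contradiction (∣⁅x⁆∪⁅y⁆∣≤2 x y)
      (<⇒≱ (proj₂ (proj₁ crit) _ (covers-pair⇒CDS adj adj-sym x-y pair)))

    -- If `y` is `u`, then `u` alone covers everything but `v`, so `u` and `v` dominate. Otherwise
    -- `y` is adjacent to `u` and must miss `v`, since `u` and `y` would be a connected dominating
    -- pair if it did not.
    arc-from-cover : ∀ {u v y} → ¬ Covers u v → Covers u y →
      (∀ s → s ≢ v → Covers u s ⊎ Covers y s) → CoveringPair u v ⊎ ∃[ z ] Arc u v z
    arc-from-cover {u} {v} ¬u-v (inj₁ refl) cov = inj₁ pair
      where
      pair : CoveringPair u v
      pair s with s ≟ v
      ... | yes s≡v = inj₂ (inj₁ s≡v)
      ... | no  s≢v = [ inj₁ , inj₁ ] (cov s s≢v)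
    arc-from-cover {u} {v} {y} ¬u-v (inj₂ u~y) cov = inj₂ (y , record
      { u~y = u~y ; v≢y = λ { refl → ¬u-v (inj₂ u~y) } ; y≁v = y≁v ; covers = cov })
      where
      y≁v : ¬ Adj adj y v
      y≁v y~v = no-covering-pair (inj₂ u~y) pair
        where
        pair : CoveringPair u y
        pair s with s ≟ v
        ... | yes refl = inj₂ (inj₂ y~v)
        ... | no  s≢v  = cov s s≢v

    -- The enlarged graph has a connected dominating set of at most two vertices `x` and `y`. If
    -- both differed from `u` and `v`, they would dominate the original graph. If one is `u` and the
    -- link to the other is old, the new edge helps to cover at most `v`, and `arc-from-cover`
    -- applies; `v` is symmetric. If only the new edge links them, they are `u` and `v`.
    trichotomy : ∀ {u v} → u ≢ v → ¬ Adj adj u v →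
      CoveringPair u v ⊎ (∃[ y ] Arc u v y) ⊎ (∃[ y ] Arc v u y)
    trichotomy {u} {v} u≢v u≁v with proj₂ crit u v u≢v u≁v
    ... | _ , ((D , cds , refl) , _) , ∣D∣<3
      with small-CDS⇒pair (addEdge adj u v) (addEdge-sym u v) u cds (≤-pred ∣D∣<3)
    ... | x , y , x-y , pair = analyse
      where
      open Covering (Adj (addEdge adj u v)) using () renaming (Covers to Covers⁺)
      restrict : ∀ {a b} → Covers⁺ a b → Covers a b ⊎ (a ≡ u × b ≡ v) ⊎ (a ≡ v × b ≡ u)
      restrict (inj₁ b≡a) = inj₁ (inj₁ b≡a)
      restrict (inj₂ a~b) = ⊎-map inj₂ id (addEdge-elim a~b)
      restrict≢ : ∀ {a b} → a ≢ u → a ≢ v → Covers⁺ a b → Covers a b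
      restrict≢ a≢u a≢v c with restrict c
      ... | inj₁ c′                = c′
      ... | inj₂ (inj₁ (a≡u , _)) = contradiction a≡u a≢u
      ... | inj₂ (inj₂ (a≡v , _)) = contradiction a≡v a≢v
      ¬u-v : ¬ Covers u v
      ¬u-v (inj₁ v≡u) = u≢v (sym v≡u)
      ¬u-v (inj₂ u~v) = u≁v u~v
      ¬v-u : ¬ Covers v u
      ¬v-u (inj₁ u≡v) = u≢v u≡v
      ¬v-u (inj₂ v~u) = u≁v (Adj-sym adj adj-sym v~u)
      flip : ∀ {a b} → CoveringPair a b → CoveringPair b a
      flip p s = ⊎-swap (p s)
      cov-sym : ∀ {a b} → Covers a b → Covers b a
      cov-sym (inj₁ b≡a) = inj₁ (sym b≡a)
      cov-sym (inj₂ a~b) = inj₂ (Adj-sym adj adj-sym a~b)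
      Goal : Set
      Goal = CoveringPair u v ⊎ (∃[ y ] Arc u v y) ⊎ (∃[ y ] Arc v u y)
      from-u : ∀ {z} → Covers u z → (∀ s → Covers⁺ u s ⊎ Covers⁺ z s) → Goal
      from-u {z} u-z p = ⊎-map id inj₁ (arc-from-cover ¬u-v u-z cov)
        where
        cov : ∀ s → s ≢ v → Covers u s ⊎ Covers z s
        cov s s≢v with p s
        ... | inj₁ c with restrict c
        ...   | inj₁ c′                 = inj₁ c′
        ...   | inj₂ (inj₁ (_ , s≡v))  = contradiction s≡v s≢v
        ...   | inj₂ (inj₂ (u≡v , _))  = contradiction u≡v u≢v
        cov s s≢v | inj₂ c with restrict c
        ...   | inj₁ c′                 = inj₂ c′
        ...   | inj₂ (inj₁ (_ , s≡v))  = contradiction s≡v s≢v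
        ...   | inj₂ (inj₂ (_ , s≡u))  = inj₁ (inj₁ s≡u)
      from-v : ∀ {z} → Covers v z → (∀ s → Covers⁺ v s ⊎ Covers⁺ z s) → Goal
      from-v {z} v-z p = ⊎-map flip inj₂ (arc-from-cover ¬v-u v-z cov)
        where
        cov : ∀ s → s ≢ u → Covers v s ⊎ Covers z s
        cov s s≢u with p s
        ... | inj₁ c with restrict c
        ...   | inj₁ c′                 = inj₁ c′
        ...   | inj₂ (inj₂ (_ , s≡u))  = contradiction s≡u s≢u
        ...   | inj₂ (inj₁ (v≡u , _))  = contradiction (sym v≡u) u≢v
        cov s s≢u | inj₂ c with restrict c
        ...   | inj₁ c′                 = inj₂ c′
        ...   | inj₂ (inj₂ (_ , s≡u))  = contradiction s≡u s≢u
        ...   | inj₂ (inj₁ (_ , s≡v))  = inj₁ (inj₁ s≡v)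
      pair-uv : (∀ s → Covers⁺ u s ⊎ Covers⁺ v s) → CoveringPair u v
      pair-uv p s with p s
      ... | inj₁ c = [ inj₁ , [ inj₂ ∘ inj₁ ∘ proj₂ , inj₁ ∘ inj₁ ∘ proj₂ ] ] (restrict c)
      ... | inj₂ c = [ inj₂ , [ inj₂ ∘ inj₁ ∘ proj₂ , inj₁ ∘ inj₁ ∘ proj₂ ] ] (restrict c)
      by-ends : ∀ {a b} → Covers a b → (∀ s → Covers⁺ a s ⊎ Covers⁺ b s) →
        Dec (a ≡ u) → Dec (a ≡ v) → Dec (b ≡ u) → Dec (b ≡ v) → Goal
      by-ends c p (yes refl) _          _          _          = from-u c p
      by-ends c p (no _)     (yes refl) _          _          = from-v c p
      by-ends c p (no _)     (no _)     (yes refl) _          = from-u (cov-sym c) (⊎-swap ∘ p)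
      by-ends c p (no _)     (no _)     (no _)     (yes refl) = from-v (cov-sym c) (⊎-swap ∘ p)
      by-ends c p (no a≢u)   (no a≢v)   (no b≢u)   (no b≢v)   = contradiction
        (λ s → ⊎-map (restrict≢ a≢u a≢v) (restrict≢ b≢u b≢v) (p s)) (no-covering-pair c)
      analyse : Goal
      analyse with restrict x-y
      ... | inj₁ c = by-ends c pair (x ≟ u) (x ≟ v) (y ≟ u) (y ≟ v)
      ... | inj₂ (inj₁ (refl , refl)) = inj₁ (pair-uv pair)
      ... | inj₂ (inj₂ (refl , refl)) = inj₁ (pair-uv (⊎-swap ∘ pair))

-- The exceptional class expressed through subsets and vertices of the graph itself, so that the
-- structural argument never handles an isomorphism. `v`, `ω` and `ω₁` correspond to `v₁`, `w` and
-- `w₁`.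
record Exceptional {n : ℕ} (_~_ : Fin n → Fin n → Set) : Set where
  field
    J₁ᵛ J₂ᵛ : Subset n
    v ω ω₁ u₁ u₂ : Fin n
    partition : ∀ s → s ∈ J₁ᵛ ⊎ s ∈ J₂ᵛ ⊎ s ≡ v ⊎ s ≡ ω₁ ⊎ s ≡ ω
    J₁∩J₂ : ∀ {s} → s ∈ J₁ᵛ → s ∉ J₂ᵛ
    v∉J₁ : v ∉ J₁ᵛ
    v∉J₂ : v ∉ J₂ᵛ
    ω₁∉J₁ : ω₁ ∉ J₁ᵛ
    ω₁∉J₂ : ω₁ ∉ J₂ᵛ
    ω∉J₁ : ω ∉ J₁ᵛ
    ω∉J₂ : ω ∉ J₂ᵛ
    v≢ω₁ : v ≢ ω₁
    v≢ω : v ≢ ω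
    ω₁≢ω : ω₁ ≢ ω
    3≤∣J₁∣ : 3 ≤ ∣ J₁ᵛ ∣
    3≤∣J₂∣ : 3 ≤ ∣ J₂ᵛ ∣
    u₁∈J₂ : u₁ ∈ J₂ᵛ
    u₂∈J₂ : u₂ ∈ J₂ᵛ
    u₁≢u₂ : u₁ ≢ u₂
    J₁-clique : ∀ {x y} → x ∈ J₁ᵛ → y ∈ J₁ᵛ → x ≢ y → x ~ y
    J₂-clique : ∀ {x y} → x ∈ J₂ᵛ → y ∈ J₂ᵛ → x ≢ y → x ~ y
    J₁≁J₂ : ∀ {x y} → x ∈ J₁ᵛ → y ∈ J₂ᵛ → ¬ (x ~ y)
    v~J₁ : ∀ {x} → x ∈ J₁ᵛ → v ~ x
    v≁J₂ : ∀ {x} → x ∈ J₂ᵛ → ¬ (v ~ x)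
    v≁ω₁ : ¬ (v ~ ω₁)
    v≁ω : ¬ (v ~ ω)
    ω₁~ω : ω₁ ~ ω
    ω₁~J₁ : ∀ {x} → x ∈ J₁ᵛ → ω₁ ~ x
    ω~J₁ : ∀ {x} → x ∈ J₁ᵛ → ω ~ x
    ω₁~J₂ : ∀ {x} → x ∈ J₂ᵛ → x ≢ u₁ → ω₁ ~ x
    ω₁≁u₁ : ¬ (ω₁ ~ u₁)
    ω~J₂ : ∀ {x} → x ∈ J₂ᵛ → x ≢ u₂ → ω ~ x
    ω≁u₂ : ¬ (ω ~ u₂)

-- Cuts of a critical graph.

module CriticalGraph {n : ℕ} (_~_ : Fin n → Fin n → Set) (_~?_ : ∀ x y → Dec (x ~ y))
  (~-sym : ∀ {x y} → x ~ y → y ~ x) (~-irrefl : ∀ {x} → ¬ (x ~ x))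
  (no-covering-pair : ∀ {x y} → Covering.Covers _~_ x y → ¬ Covering.CoveringPair _~_ x y)
  (trichotomy : ∀ {u v} → u ≢ v → ¬ (u ~ v) → Covering.CoveringPair _~_ u v
    ⊎ (∃[ y ] Covering.Arc _~_ u v y) ⊎ (∃[ y ] Covering.Arc _~_ v u y))
  where
  open Covering _~_

  covers-out : ∀ {x s} → s ≢ x → ¬ (x ~ s) → ¬ Covers x s
  covers-out s≢x x≁s = [ s≢x , x≁s ]

  covers? : ∀ x s → Dec (Covers x s)
  covers? x s = (s ≟ x) ⊎-dec (x ~? s)

  -- The sides are unions of components of the complement of `S` and need not be connected. The
  -- description is symmetric, and `swap-cut` halves the case analyses.
  record Cut (S A B : Subset n) : Set where
    field
      cover    : ∀ s → s ∈ A ⊎ s ∈ B ⊎ s ∈ S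
      A∩B      : ∀ {s} → s ∈ A → s ∉ B
      A∩S      : ∀ {s} → s ∈ A → s ∉ S
      B∩S      : ∀ {s} → s ∈ B → s ∉ S
      A≁B      : ∀ {x y} → x ∈ A → y ∈ B → ¬ (x ~ y)
      A-member : ∃[ x ] x ∈ A
      B-member : ∃[ x ] x ∈ B

  open Cut

  swap-cut : ∀ {S A B} → Cut S A B → Cut S B A
  swap-cut C = record
    { cover    = λ s → [ inj₂ ∘ inj₁ , [ inj₁ , inj₂ ∘ inj₂ ] ] (cover C s)
    ; A∩B      = λ s∈B s∈A → A∩B C s∈A s∈B
    ; A∩S      = B∩S C
    ; B∩S      = A∩S C
    ; A≁B      = λ x∈B y∈A x~y → A≁B C y∈A x∈B (~-sym x~y)
    ; A-member = B-member C
    ; B-member = A-member C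
    }

  -- The inequality |S| < δ enters through `escape`: a set of at most |S| vertices contains no whole
  -- neighbourhood.
  module WithSet (S : Subset n)
    (escape : ∀ x (Q : Subset n) → ∣ Q ∣ ≤ ∣ S ∣ → ∃[ y ] (x ~ y × y ∉ Q)) where

    A-B : ∀ {A B} → Cut S A B → ∀ {x y} → x ∈ A → y ∈ B → ¬ Covers x y
    A-B C x∈A y∈B (inj₁ refl) = A∩B C x∈A y∈B
    A-B C x∈A y∈B (inj₂ x~y)  = A≁B C x∈A y∈B x~y

    B-A : ∀ {A B} → Cut S A B → ∀ {x y} → x ∈ B → y ∈ A → ¬ Covers x y
    B-A C = A-B (swap-cut C)

    A-neighbour : ∀ {A B} → Cut S A B → ∀ {x} → x ∈ A → ∃[ y ] (y ∈ A × x ~ y)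
    A-neighbour C {x} x∈A with escape x S ≤-refl
    ... | y , x~y , y∉S with cover C y
    ...   | inj₁ y∈A        = y , y∈A , x~y
    ...   | inj₂ (inj₁ y∈B) = contradiction x~y (A≁B C x∈A y∈B)
    ...   | inj₂ (inj₂ y∈S) = contradiction y∈S y∉S

    A-other : ∀ {A B} → Cut S A B → ∀ v → ∃[ x ] (x ∈ A × x ≢ v)
    A-other C v with A-member C
    ... | x , x∈A with x ≟ v
    ...   | no x≢v = x , x∈A , x≢v
    ...   | yes refl with A-neighbour C x∈A
    ...     | y , y∈A , x~y = y , y∈A , λ { refl → ~-irrefl x~y }

    -- Some vertex `b ≢ v` of `B` must be covered. Since `x ∈ A` cannot cover it, `y` is not in `A`;
    -- being adjacent to `x`, it is not in `B` either.
    arc-middle∈S : ∀ {A B} → Cut S A B → ∀ {x v y} → x ∈ A → Arc x v y → y ∈ S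
    arc-middle∈S C {x} {v} {y} x∈A arc with A-other (swap-cut C) v
    ... | b , b∈B , b≢v with cover C y
    ...   | inj₂ (inj₂ y∈S) = y∈S
    ...   | inj₂ (inj₁ y∈B) = contradiction (Arc.u~y arc) (A≁B C x∈A y∈B)
    ...   | inj₁ y∈A        = contradiction (Arc.covers arc b b≢v) [ A-B C x∈A b∈B , A-B C y∈A b∈B ]

    arc-middle∈S′ : ∀ {A B} → Cut S A B → ∀ {x v y} → x ∉ S → Arc x v y → y ∈ S
    arc-middle∈S′ C {x} x∉S arc with cover C x
    ... | inj₁ x∈A        = arc-middle∈S C x∈A arc
    ... | inj₂ (inj₁ x∈B) = arc-middle∈S (swap-cut C) x∈B arc
    ... | inj₂ (inj₂ x∈S) = contradiction x∈S x∉S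

    cross : ∀ {A B} → Cut S A B → ∀ {x y} → x ∈ A → y ∈ B →
      CoveringPair x y ⊎ (∃[ z ] (z ∈ S × Arc x y z)) ⊎ (∃[ z ] (z ∈ S × Arc y x z))
    cross C {x} {y} x∈A y∈B with trichotomy (≢-by-∈ x∈A (λ y∈A → A∩B C y∈A y∈B)) (A≁B C x∈A y∈B)
    ... | inj₁ pair             = inj₁ pair
    ... | inj₂ (inj₁ (z , arc)) = inj₂ (inj₁ (z , arc-middle∈S C x∈A arc , arc))
    ... | inj₂ (inj₂ (z , arc)) = inj₂ (inj₂ (z , arc-middle∈S (swap-cut C) y∈B arc , arc))

    pair-covers-A : ∀ {A B} → Cut S A B → ∀ {x y s} → CoveringPair x y → y ∈ B → s ∈ A → Covers x s
    pair-covers-A C {s = s} pair y∈B s∈A with pair s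
    ... | inj₁ c = c
    ... | inj₂ c = contradiction c (B-A C y∈B s∈A)

    pair-covers-B : ∀ {A B} → Cut S A B → ∀ {x y s} → CoveringPair x y → x ∈ A → s ∈ B → Covers y s
    pair-covers-B C {s = s} pair x∈A s∈B with pair s
    ... | inj₁ c = contradiction c (A-B C x∈A s∈B)
    ... | inj₂ c = c

    -- Cuts of at most one vertex.

    module SmallCut (∣S∣≤1 : ∣ S ∣ ≤ 1)
      (connected : ∀ (Q : Subset n) → (∀ {x y} → x ∈ Q → x ~ y → y ∈ Q) → ∀ {x y} → x ∈ Q → y ∈ Q)
      where

      S-unique : ∀ {x y} → x ∈ S → y ∈ S → y ≡ x
      S-unique {x} {y} x∈S y∈S with y ≟ x
      ... | yes y≡x = y≡x
      ... | no  y≢x = contradiction (≤-trans (x∈p⇒∣p-x∣<∣p∣ x∈S) ∣S∣≤1)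
        (<⇒≱ (s≤s (x∈p⇒0<∣p∣ (x∈p∧x≢y⇒x∈p-y y∈S y≢x))))

      A-touches-S : ∀ {A B} → Cut S A B → ∃[ x ] (x ∈ A × ∃[ y ] (y ∈ S × x ~ y))
      A-touches-S {A} C with any? (λ x → (x ∈? A) ×-dec any? (λ y → (y ∈? S) ×-dec (x ~? y)))
      ... | yes touch = touch
      ... | no none = ⊥-elim (A∩B C (connected A closed (proj₂ (A-member C))) (proj₂ (B-member C)))
        where
        closed : ∀ {x y} → x ∈ A → x ~ y → y ∈ A
        closed {x} {y} x∈A x~y with cover C y
        ... | inj₁ y∈A        = y∈A
        ... | inj₂ (inj₁ y∈B) = contradiction x~y (A≁B C x∈A y∈B)
        ... | inj₂ (inj₂ y∈S) = ⊥-elim (none (x , x∈A , y , y∈S , x~y))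

      -- First, `v` is adjacent to all of `B`: each outcome of `cross` for `c` and `d ∈ B`
      -- contradicts `c≁v` or gives `d ~ v`. With a neighbour `c′ ∈ A`, `v` still misses some
      -- `c₀ ∈ A`. For `c₀` and `d`, `cross` leaves only an arc from `d` to `c₀` through `v`; so `v`
      -- covers `A` except `c₀`, and `v` with a neighbour `c₃` of `c₀` dominates.
      cut-vertex-nonadjacent : ∀ {A B} → Cut S A B → ∀ {v c} → v ∈ S → c ∈ A → ¬ (c ~ v) → ⊥
      cut-vertex-nonadjacent {A} {B} C {v} {c} v∈S c∈A c≁v with A-touches-S C
      ... | c′ , c′∈A , v′ , v′∈S , c′~v′ with S-unique v∈S v′∈S
      ... | refl = conclude (¬∀⟶∃¬ n _ (λ s → covers? c′ s ⊎-dec covers? v s) (no-covering-pair (inj₂ c′~v′)))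
        where
        v~B : ∀ {d} → d ∈ B → v ~ d
        v~B {d} d∈B with cross C c∈A d∈B
        ... | inj₂ (inj₁ (z , z∈S , arc)) with S-unique v∈S z∈S
        ...   | refl = contradiction (Arc.u~y arc) c≁v
        v~B {d} d∈B | inj₂ (inj₂ (z , z∈S , arc)) with S-unique v∈S z∈S
        ...   | refl = ~-sym (Arc.u~y arc)
        v~B {d} d∈B | inj₁ pair with pair v
        ...   | inj₁ c-v          = contradiction c-v (covers-out (λ { refl → A∩S C c∈A v∈S }) c≁v)
        ...   | inj₂ (inj₁ refl)  = contradiction v∈S (B∩S C d∈B)
        ...   | inj₂ (inj₂ d~v)   = ~-sym d~v
        conclude : ∃[ s ] ¬ (Covers c′ s ⊎ Covers v s) → ⊥
        conclude (c₀ , uncovered) with cover C c₀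
        ... | inj₂ (inj₂ c₀∈S) = uncovered (inj₂ (inj₁ (S-unique v∈S c₀∈S)))
        ... | inj₂ (inj₁ c₀∈B) = uncovered (inj₂ (inj₂ (v~B c₀∈B)))
        ... | inj₁ c₀∈A with B-member C
        ... | d , d∈B with cross C c₀∈A d∈B
        ... | inj₁ pair = [ (λ { refl → uncovered (inj₁ (inj₁ refl)) })
                          , (λ c₀~c′ → uncovered (inj₁ (inj₂ (~-sym c₀~c′)))) ]
                          (pair-covers-A C pair d∈B c′∈A)
        ... | inj₂ (inj₁ (z , z∈S , arc)) with S-unique v∈S z∈S
        ...   | refl = uncovered (inj₂ (inj₂ (~-sym (Arc.u~y arc))))
        conclude (c₀ , uncovered) | inj₁ c₀∈A | d , d∈B | inj₂ (inj₂ (z , z∈S , arc)) with S-unique v∈S z∈S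
        ...   | refl with A-neighbour C c₀∈A
        ...     | c₃ , c₃∈A , c₀~c₃ = no-covering-pair
          (inj₂ (~-sym (v~A c₃∈A λ { refl → ~-irrefl c₀~c₃ }))) pair
          where
          v~A : ∀ {s} → s ∈ A → s ≢ c₀ → v ~ s
          v~A {s} s∈A s≢c₀ with Arc.covers arc s s≢c₀
          ... | inj₁ c           = contradiction c (B-A C d∈B s∈A)
          ... | inj₂ (inj₁ refl) = contradiction v∈S (A∩S C s∈A)
          ... | inj₂ (inj₂ v~s)  = v~s
          pair : CoveringPair c₃ v
          pair s with cover C s
          ... | inj₂ (inj₁ s∈B) = inj₂ (inj₂ (v~B s∈B))
          ... | inj₂ (inj₂ s∈S) = inj₂ (inj₁ (S-unique v∈S s∈S))
          ... | inj₁ s∈A with s ≟ c₀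
          ...   | yes refl = inj₁ (inj₂ (~-sym c₀~c₃))
          ...   | no s≢c₀  = inj₂ (inj₂ (v~A s∈A s≢c₀))

      no-small-cut : ∀ {A B} → ¬ Cut S A B
      no-small-cut C with A-touches-S C
      ... | _ , _ , v , v∈S , _
        -- The cut vertex alone does not dominate, so one side contains a non-neighbour of it.
        with ¬∀⟶∃¬ n _ (λ s → covers? v s) (λ all → no-covering-pair {v} (inj₁ refl) (inj₁ ∘ all))
      ... | c , uncovered with cover C c
      ... | inj₁ c∈A        = cut-vertex-nonadjacent C v∈S c∈A (uncovered ∘ inj₂ ∘ ~-sym)
      ... | inj₂ (inj₁ c∈B) = cut-vertex-nonadjacent (swap-cut C) v∈S c∈B (uncovered ∘ inj₂ ∘ ~-sym)
      ... | inj₂ (inj₂ c∈S) = uncovered (inj₁ (S-unique v∈S c∈S))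

    -- Cuts of at least two vertices and a larger independent set.

    module LargeCut (2≤∣S∣ : 2 ≤ ∣ S ∣) (I : Subset n)
      (independent : ∀ {x y} → x ∈ I → y ∈ I → ¬ (x ~ y)) (∣S∣<∣I∣ : ∣ S ∣ < ∣ I ∣) where

      third : ∀ x y → ∃[ z ] (z ∈ I × z ≢ x × z ≢ y)
      third x y with ∣p∣<∣q∣⇒∃∈q∉p (⁅ x ⁆ ∪ ⁅ y ⁆) I (≤-<-trans (≤-trans (∣⁅x⁆∪⁅y⁆∣≤2 x y) 2≤∣S∣) ∣S∣<∣I∣)
      ... | z , z∈I , z∉ = z , z∈I , (λ { refl → z∉ (x∈⁅x⁆∪⁅y⁆ x y) }) , (λ { refl → z∉ (y∈⁅x⁆∪⁅y⁆ x y) })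

      I-uncovered : ∀ {x y} → x ∈ I → y ∈ I → y ≢ x → ¬ Covers x y
      I-uncovered x∈I y∈I y≢x = covers-out y≢x (independent x∈I y∈I)

      -- Two vertices of `I` never dominate, since they leave a third one uncovered.
      tournament : ∀ {u v} → u ∈ I → v ∈ I → u ≢ v → (∃[ y ] Arc u v y) ⊎ (∃[ y ] Arc v u y)
      tournament {u} {v} u∈I v∈I u≢v with trichotomy u≢v (independent u∈I v∈I)
      ... | inj₂ arc  = arc
      ... | inj₁ pair with third u v
      ...   | z , z∈I , z≢u , z≢v =
        contradiction (pair z) [ I-uncovered u∈I z∈I z≢u , I-uncovered v∈I z∈I z≢v ]

      -- What an arc to `h` through `y` leaves on `I` once its start is forgotten; arcs with
      -- different starts can then be counted together.
      Marks : Fin n → Fin n → Set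
      Marks y h = y ∈ S × y ∉ I × ¬ (y ~ h) × (∀ i → i ∈ I → i ≢ h → y ~ i)

      marks? : ∀ y h → Dec (Marks y h)
      marks? y h = (y ∈? S) ×-dec (¬? (y ∈? I) ×-dec (¬? (y ~? h) ×-dec
        all? (λ i → (i ∈? I) →-dec (¬? (i ≟ h) →-dec (y ~? i)))))

      -- Within `I` the start `u` covers only itself, so `y` has to cover all the rest except `v`.
      arc⇒marks : ∀ {u v y} → u ∈ I → y ∈ S → Arc u v y → Marks y v
      arc⇒marks {u} {v} {y} u∈I y∈S arc = y∈S , y∉I , Arc.y≁v arc , y~I
        where
        y∉I : y ∉ I
        y∉I y∈I = independent u∈I y∈I (Arc.u~y arc)
        y~I : ∀ i → i ∈ I → i ≢ v → y ~ i
        y~I i i∈I i≢v with i ≟ u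
        ... | yes refl = ~-sym (Arc.u~y arc)
        ... | no  i≢u with Arc.covers arc i i≢v
        ...   | inj₁ c           = contradiction c (I-uncovered u∈I i∈I i≢u)
        ...   | inj₂ (inj₁ refl) = contradiction i∈I y∉I
        ...   | inj₂ (inj₂ y~i)  = y~i

      marks-functional : ∀ {y h h′} → h ∈ I → Marks y h → Marks y h′ → h ≡ h′
      marks-functional {h = h} {h′} h∈I (_ , _ , y≁h , _) (_ , _ , _ , y~I) with h ≟ h′
      ... | yes h≡h′ = h≡h′
      ... | no  h≢h′ = contradiction (y~I h h∈I h≢h′) y≁h

      -- |I ∖ S| > |S ∖ I|, since |I| > |S|.
      no-injection : (R : Fin n → Fin n → Set) →
        (∀ {a} → a ∈ I → a ∉ S → ∃[ y ] (y ∈ S × y ∉ I × R a y)) →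
        (∀ {a a′ y} → a ∈ I → a′ ∈ I → R a y → R a′ y → a ≡ a′) → ⊥
      no-injection R total inj = <⇒≱ ∣S∣<∣I∣ (pigeonhole I S R⁺ total⁺ inj⁺)
        where
        R⁺ : Fin n → Fin n → Set
        -- Vertices of `I ∩ S` are matched with themselves; `y ∉ I` keeps them apart from the
        -- partners supplied by `R`.
        R⁺ a y = a ∈ I × ((y ≡ a) ⊎ (y ∉ I × R a y))
        total⁺ : ∀ {a} → a ∈ I → ∃[ y ] (y ∈ S × R⁺ a y)
        total⁺ {a} a∈I with a ∈? S
        ... | yes a∈S = a , a∈S , a∈I , inj₁ refl
        ... | no  a∉S with total a∈I a∉S
        ...   | y , y∈S , y∉I , r = y , y∈S , a∈I , inj₂ (y∉I , r)
        inj⁺ : ∀ {a a′ y} → R⁺ a y → R⁺ a′ y → a ≡ a′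
        inj⁺ (_ , inj₁ refl)           (_ , inj₁ refl)             = refl
        inj⁺ (a∈I , inj₁ refl)         (_ , inj₂ (y∉I , _))        = contradiction a∈I y∉I
        inj⁺ (_ , inj₂ (y∉I , _))      (a′∈I , inj₁ refl)          = contradiction a′∈I y∉I
        inj⁺ (a∈I , inj₂ (_ , r))      (a′∈I , inj₂ (_ , r′))      = inj a∈I a′∈I r r′

      unmarked : ∃[ x ] (x ∈ I × x ∉ S × (∀ {y} → ¬ Marks y x))
      unmarked with any? (λ x → (x ∈? I) ×-dec (¬? (x ∈? S) ×-dec ¬? (any? (λ y → marks? y x))))
      ... | yes (x , x∈I , x∉S , none) = x , x∈I , x∉S , λ m → none (_ , m)
      ... | no none = ⊥-elim (no-injection (λ a y → Marks y a) total (λ a∈I _ → marks-functional a∈I))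
        where
        total : ∀ {a} → a ∈ I → a ∉ S → ∃[ y ] (y ∈ S × y ∉ I × Marks y a)
        total {a} a∈I a∉S with any? (λ y → marks? y a)
        ... | yes (y , m) = y , proj₁ m , proj₁ (proj₂ m) , m
        ... | no ¬marked  = ⊥-elim (none (a , a∈I , a∉S , ¬marked))

      -- The tight count around an unmarked vertex `x₀`.

      module Unmarked {A B} (C : Cut S A B) {x₀} (x₀∈I : x₀ ∈ I) (x₀∈A : x₀ ∈ A)
        (x₀-unmarked : ∀ {y} → ¬ Marks y x₀) where

        x₀∉S : x₀ ∉ S
        x₀∉S = A∩S C x₀∈A

        -- The opposite arc, from `a` to `x₀`, would have its middle in `S` and mark `x₀`.
        arc-to : ∀ {a} → a ∈ I → a ∉ S → a ≢ x₀ → ∃[ y ] (Arc x₀ a y × Marks y a)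
        arc-to {a} a∈I a∉S a≢x₀ with tournament x₀∈I a∈I (≢-sym a≢x₀)
        ... | inj₁ (y , arc) = y , arc , arc⇒marks x₀∈I (arc-middle∈S C x₀∈A arc) arc
        ... | inj₂ (y , arc) = ⊥-elim (x₀-unmarked (arc⇒marks a∈I (arc-middle∈S′ C a∉S arc) arc))

        -- Tightness: if the other vertices of `I ∖ S` had markers avoiding `y′`, the spare vertex
        -- `y′` could be assigned to `x₀`, and `I ∖ S` would inject into `S ∖ I`.
        no-injection′ : ∀ {y′} → y′ ∈ S → y′ ∉ I →
          (∀ {a} → a ∈ I → a ∉ S → a ≢ x₀ → ∃[ y ] (y ≢ y′ × Marks y a)) → ⊥
        no-injection′ {y′} y′∈S y′∉I total = no-injection R total′ inj
          where
          R : Fin n → Fin n → Set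
          R a y = (a ≡ x₀ × y ≡ y′) ⊎ (y ≢ y′ × Marks y a)
          total′ : ∀ {a} → a ∈ I → a ∉ S → ∃[ y ] (y ∈ S × y ∉ I × R a y)
          total′ {a} a∈I a∉S with a ≟ x₀
          ... | yes a≡x₀ = y′ , y′∈S , y′∉I , inj₁ (a≡x₀ , refl)
          ... | no  a≢x₀ with total a∈I a∉S a≢x₀
          ...   | y , y≢y′ , m = y , proj₁ m , proj₁ (proj₂ m) , inj₂ (y≢y′ , m)
          inj : ∀ {a a′ y} → a ∈ I → a′ ∈ I → R a y → R a′ y → a ≡ a′
          inj _   _ (inj₁ (refl , _))    (inj₁ (refl , _))    = refl
          inj _   _ (inj₁ (_ , y≡y′))    (inj₂ (y≢y′ , _))    = contradiction y≡y′ y≢y′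
          inj _   _ (inj₂ (y≢y′ , _))    (inj₁ (_ , y≡y′))    = contradiction y≡y′ y≢y′
          inj a∈I _ (inj₂ (_ , m))       (inj₂ (_ , m′))      = marks-functional a∈I m m′

        -- A marker of `p ∈ S` marks nothing in `I ∖ S`, hence would be spare.
        S∩I-unmarked : ∀ {p y} → p ∈ I → p ∈ S → ¬ Marks y p
        S∩I-unmarked {p} {y} p∈I p∈S m = no-injection′ (proj₁ m) (proj₁ (proj₂ m)) total
          where
          total : ∀ {a} → a ∈ I → a ∉ S → a ≢ x₀ → ∃[ y′ ] (y′ ≢ y × Marks y′ a)
          total a∈I a∉S a≢x₀ with arc-to a∈I a∉S a≢x₀
          ... | y′ , _ , m′ = y′ , (λ { refl → ≢-by-∈ p∈S a∉S (marks-functional p∈I m m′) }) , m′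

        -- Of two markers of `a`, one would be spare.
        marker-unique : ∀ {a y y′} → a ∈ I → Marks y a → Marks y′ a → y′ ≡ y
        marker-unique {a} {y} {y′} a∈I m m′ with y′ ≟ y
        ... | yes y′≡y = y′≡y
        ... | no  y′≢y = ⊥-elim (no-injection′ (proj₁ m) (proj₁ (proj₂ m)) total)
          where
          total : ∀ {b} → b ∈ I → b ∉ S → b ≢ x₀ → ∃[ z ] (z ≢ y × Marks z b)
          total {b} b∈I b∉S b≢x₀ with b ≟ a
          ... | yes refl = y′ , y′≢y , m′
          ... | no  b≢a with arc-to b∈I b∉S b≢x₀
          ...   | z , _ , mz = z , (λ { refl → b≢a (marks-functional b∈I mz m) }) , mz

        marked-by : ∀ {y} → y ∈ S → y ∉ I →
          ∃[ a ] (a ∈ I × a ∉ S × a ≢ x₀ × Arc x₀ a y × Marks y a)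
        marked-by {y} y∈S y∉I
          with any? (λ a → (a ∈? I) ×-dec (¬? (a ∈? S) ×-dec (¬? (a ≟ x₀) ×-dec marks? y a)))
        ... | yes (a , a∈I , a∉S , a≢x₀ , m) with arc-to a∈I a∉S a≢x₀
        ...   | y′ , arc , m′ with marker-unique a∈I m m′
        ...     | refl = a , a∈I , a∉S , a≢x₀ , arc , m
        marked-by {y} y∈S y∉I | no none = ⊥-elim (no-injection′ y∈S y∉I total)
          where
          total : ∀ {a} → a ∈ I → a ∉ S → a ≢ x₀ → ∃[ y′ ] (y′ ≢ y × Marks y′ a)
          total {a} a∈I a∉S a≢x₀ with arc-to a∈I a∉S a≢x₀
          ... | y′ , _ , m = y′ , (λ { refl → none (a , a∈I , a∉S , a≢x₀ , m) }) , m

        S∖I~x₀ : ∀ {y} → y ∈ S → y ∉ I → y ~ x₀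
        S∖I~x₀ y∈S y∉I with marked-by y∈S y∉I
        ... | a , _ , _ , a≢x₀ , _ , (_ , _ , _ , y~I) = y~I x₀ x₀∈I (≢-sym a≢x₀)

        S-non-neighbour∈I : ∀ {y} → y ∈ S → ¬ (y ~ x₀) → y ∈ I
        S-non-neighbour∈I {y} y∈S y≁x₀ = decidable-stable (y ∈? I) (y≁x₀ ∘ S∖I~x₀ y∈S)

        S-neighbour∉I : ∀ {y} → x₀ ~ y → y ∉ I
        S-neighbour∉I x₀~y y∈I = independent x₀∈I y∈I x₀~y

        -- `y` is the middle of an arc from `x₀ ∈ A` to some `a ∈ I`; `x₀` cannot cover `c ∈ B`, and
        -- `c ≢ a` as `c ∉ I`.
        S∖I~B : ∀ {y c} → y ∈ S → y ∉ I → c ∈ B → c ∉ I → y ~ c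
        S∖I~B {y} {c} y∈S y∉I c∈B c∉I with marked-by y∈S y∉I
        ... | a , a∈I , _ , _ , arc , _ with Arc.covers arc c (≢-sym (≢-by-∈ a∈I c∉I))
        ...   | inj₁ cov         = contradiction cov (A-B C x₀∈A c∈B)
        ...   | inj₂ (inj₁ refl) = contradiction y∈S (B∩S C c∈B)
        ...   | inj₂ (inj₂ y~c)  = y~c

        B∖I-member : ∃[ c ] (c ∈ B × c ∉ I)
        B∖I-member with B-member C
        ... | b , b∈B with b ∈? I
        ...   | no b∉I  = b , b∈B , b∉I
        ...   | yes b∈I with A-neighbour (swap-cut C) b∈B
        ...     | c , c∈B , b~c = c , c∈B , λ c∈I → independent b∈I c∈I b~c

        -- Suppose `a ∈ A` and apply `cross` to `x₀` and some `c ∈ B` outside `I`. A covering pair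
        -- fails to cover `a`. The middle of an arc `x₀ → c` lies outside `I` and is adjacent to `c`
        -- by `S∖I~B`. The middle of an arc `c → x₀` misses `x₀`, so lies in `I` and cannot cover
        -- `a`.
        I∖S⊆B : ∀ {a} → a ∈ I → a ∉ S → a ≢ x₀ → a ∈ B
        I∖S⊆B {a} a∈I a∉S a≢x₀ with cover C a
        ... | inj₂ (inj₁ a∈B) = a∈B
        ... | inj₂ (inj₂ a∈S) = contradiction a∈S a∉S
        ... | inj₁ a∈A with B∖I-member
        ... | c , c∈B , c∉I with cross C x₀∈A c∈B
        ...   | inj₁ pair = contradiction (pair-covers-A C pair c∈B a∈A) (I-uncovered x₀∈I a∈I a≢x₀)
        ...   | inj₂ (inj₁ (q , q∈S , arc)) = contradiction
          (S∖I~B q∈S (S-neighbour∉I (Arc.u~y arc)) c∈B c∉I) (Arc.y≁v arc)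
        ...   | inj₂ (inj₂ (q , q∈S , arc)) = contradiction (Arc.covers arc a a≢x₀)
          [ B-A C c∈B a∈A , I-uncovered (S-non-neighbour∈I q∈S (Arc.y≁v arc)) a∈I (≢-sym (≢-by-∈ q∈S a∉S)) ]

        -- Neither `p` nor `x₀` is marked. An arc from `x₀` would mark `p`, and an arc from `p` with
        -- middle in `S` would mark `x₀`.
        arc-to-x₀ : ∀ {p} → p ∈ I → p ∈ S → ∃[ z ] (z ∉ S × Arc p x₀ z)
        arc-to-x₀ {p} p∈I p∈S with tournament p∈I x₀∈I (≢-by-∈ p∈S x₀∉S)
        ... | inj₁ (z , arc) = z , (λ z∈S → x₀-unmarked (arc⇒marks p∈I z∈S arc)) , arc
        ... | inj₂ (z , arc) = ⊥-elim (S∩I-unmarked p∈I p∈S (arc⇒marks x₀∈I (arc-middle∈S C x₀∈A arc) arc))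

        S∩I~A-via : ∀ {p z} → p ∈ S → Arc p x₀ z → z ∈ B → ∀ {d} → d ∈ A → d ≢ x₀ → p ~ d
        S∩I~A-via p∈S arc z∈B {d} d∈A d≢x₀ with Arc.covers arc d d≢x₀
        ... | inj₁ (inj₁ refl) = contradiction p∈S (A∩S C d∈A)
        ... | inj₁ (inj₂ p~d)  = p~d
        ... | inj₂ c           = contradiction c (B-A C z∈B d∈A)

        -- The middle `z` of the arc from `p` to `x₀` must cover `a ∈ B`, and `z ∉ S`, so `z ∈ B`.
        -- It covers nothing in `A`, which leaves `A` except `x₀` to `p`.
        S∩I~A : ∀ {a} → a ∈ I → a ∉ S → a ≢ x₀ → ∀ {p} → p ∈ I → p ∈ S →
          ∀ {d} → d ∈ A → d ≢ x₀ → p ~ d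
        S∩I~A {a} a∈I a∉S a≢x₀ {p} p∈I p∈S with arc-to-x₀ p∈I p∈S
        ... | z , z∉S , arc = S∩I~A-via p∈S arc z∈B
          where
          z~a : z ~ a
          z~a with Arc.covers arc a a≢x₀
          ... | inj₁ c           = contradiction c (I-uncovered p∈I a∈I (≢-sym (≢-by-∈ p∈S a∉S)))
          ... | inj₂ (inj₁ refl) = contradiction (Arc.u~y arc) (independent p∈I a∈I)
          ... | inj₂ (inj₂ z~a)  = z~a
          z∈B : z ∈ B
          z∈B with cover C z
          ... | inj₁ z∈A        = contradiction z~a (A≁B C z∈A (I∖S⊆B a∈I a∉S a≢x₀))
          ... | inj₂ (inj₁ z∈B) = z∈B
          ... | inj₂ (inj₂ z∈S) = contradiction z∈S z∉S

        A-second : ∃[ d ] (d ∈ A × d ≢ x₀)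
        A-second = A-other C x₀

        -- If `I ∖ S` is only `x₀`, then `S ⊆ I` by `marked-by`. `cross` makes `B` completely
        -- adjacent to `S`, and makes each `d ∈ A` other than `x₀` a covering pair with `e ∈ B`. The
        -- arcs from `S` to `x₀` then have middles in `B`, so `S` is adjacent to all such `d`. Now
        -- any `q ∈ S` covers `B`, and `d` covers `A` and `S`.
        I∖S-has-second : (∀ {a} → a ∈ I → a ∉ S → ¬ (a ≢ x₀)) → ⊥
        I∖S-has-second only-x₀ = no-covering-pair (inj₂ (q~A (proj₂ S-member) d∈A d≢x₀)) pair
          where
          S⊆I : ∀ {y} → y ∈ S → y ∈ I
          S⊆I {y} y∈S = decidable-stable (y ∈? I) λ y∉I →
            let a , a∈I , a∉S , a≢x₀ , _ = marked-by y∈S y∉I in only-x₀ a∈I a∉S a≢x₀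
          e : Fin n
          e = proj₁ (B-member C)
          e∈B : e ∈ B
          e∈B = proj₂ (B-member C)
          x₀≁S : ∀ {y} → y ∈ S → ¬ (x₀ ~ y)
          x₀≁S y∈S = independent x₀∈I (S⊆I y∈S)
          S-uncovered : ∀ {x y} → x ∈ S → y ∈ S → y ≢ x → ¬ Covers x y
          S-uncovered x∈S y∈S = I-uncovered (S⊆I x∈S) (S⊆I y∈S)
          B~S : ∀ {b} → b ∈ B → ∀ {y} → y ∈ S → b ~ y
          B~S {b} b∈B {y} y∈S with cross C x₀∈A b∈B
          ... | inj₂ (inj₁ (q , q∈S , arc)) = contradiction (Arc.u~y arc) (x₀≁S q∈S)
          ... | inj₁ pair with pair y
          ...   | inj₁ c           = contradiction c (covers-out (≢-by-∈ y∈S x₀∉S) (x₀≁S y∈S))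
          ...   | inj₂ (inj₁ refl) = contradiction y∈S (B∩S C b∈B)
          ...   | inj₂ (inj₂ b~y)  = b~y
          B~S {b} b∈B {y} y∈S | inj₂ (inj₂ (q , q∈S , arc)) with y ≟ q
          ...   | yes refl = Arc.u~y arc
          ...   | no  y≢q with Arc.covers arc y (≢-by-∈ y∈S x₀∉S)
          ...     | inj₁ (inj₁ refl) = contradiction y∈S (B∩S C b∈B)
          ...     | inj₁ (inj₂ b~y)  = b~y
          ...     | inj₂ c           = contradiction c (S-uncovered q∈S y∈S y≢q)
          covering : ∀ {d} → d ∈ A → d ≢ x₀ → CoveringPair d e
          covering d∈A d≢x₀ with cross C d∈A e∈B
          ... | inj₁ pair = pair
          ... | inj₂ (inj₁ (q , q∈S , arc)) = contradiction (~-sym (B~S e∈B q∈S)) (Arc.y≁v arc)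
          ... | inj₂ (inj₂ (q , q∈S , arc)) = ⊥-elim ([ B-A C e∈B x₀∈A
            , covers-out (≢-sym (≢-by-∈ q∈S x₀∉S)) (x₀≁S q∈S ∘ ~-sym) ] (Arc.covers arc x₀ (≢-sym d≢x₀)))
          q~A : ∀ {q} → q ∈ S → ∀ {d} → d ∈ A → d ≢ x₀ → q ~ d
          q~A {q} q∈S with arc-to-x₀ (S⊆I q∈S) q∈S
          ... | z , z∉S , arc = S∩I~A-via q∈S arc z∈B
            where
            z∈B : z ∈ B
            z∈B with cover C z
            ... | inj₂ (inj₁ z∈B) = z∈B
            ... | inj₂ (inj₂ z∈S) = contradiction z∈S z∉S
            ... | inj₁ z∈A with pair-covers-A C (covering z∈A (≢-sym (Arc.v≢y arc))) e∈B x₀∈A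
            ...   | inj₁ x₀≡z = contradiction x₀≡z (Arc.v≢y arc)
            ...   | inj₂ z~x₀ = contradiction z~x₀ (Arc.y≁v arc)
          d : Fin n
          d = proj₁ A-second
          d∈A : d ∈ A
          d∈A = proj₁ (proj₂ A-second)
          d≢x₀ : d ≢ x₀
          d≢x₀ = proj₂ (proj₂ A-second)
          S-member : ∃[ q ] q ∈ S
          S-member with ∣p∣<∣q∣⇒∃∈q∉p ⊥ˢ S (subst (_< ∣ S ∣) (sym (∣⊥∣≡0 n)) (≤-trans (s≤s z≤n) 2≤∣S∣))
          ... | q , q∈S , _ = q , q∈S
          q : Fin n
          q = proj₁ S-member
          pair : CoveringPair q d
          pair s with cover C s
          ... | inj₁ s∈A = inj₂ (pair-covers-A C (covering d∈A d≢x₀) e∈B s∈A)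
          ... | inj₂ (inj₁ s∈B) = inj₁ (inj₂ (~-sym (B~S s∈B (proj₂ S-member))))
          ... | inj₂ (inj₂ s∈S) = inj₂ (inj₂ (~-sym (q~A s∈S d∈A d≢x₀)))

        -- A second vertex `a` of `I ∖ S`.

        module Second {a} (a∈I : a ∈ I) (a∉S : a ∉ S) (a≢x₀ : a ≢ x₀) where

          a∈B : a ∈ B
          a∈B = I∖S⊆B a∈I a∉S a≢x₀

          p~A : ∀ {p} → p ∈ I → p ∈ S → ∀ {d} → d ∈ A → d ≢ x₀ → p ~ d
          p~A = S∩I~A a∈I a∉S a≢x₀

          S∩I-misses : ∀ {q b} → q ∈ S → q ∈ I → b ∈ I → b ∉ S → ¬ Covers q b
          S∩I-misses q∈S q∈I b∈I b∉S = I-uncovered q∈I b∈I (≢-sym (≢-by-∈ q∈S b∉S))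

          y : Fin n
          y = proj₁ (arc-to a∈I a∉S a≢x₀)

          y-arc : Arc x₀ a y
          y-arc = proj₁ (proj₂ (arc-to a∈I a∉S a≢x₀))

          y-marks : Marks y a
          y-marks = proj₂ (proj₂ (arc-to a∈I a∉S a≢x₀))

          y∈S : y ∈ S
          y∈S = proj₁ y-marks

          y∉I : y ∉ I
          y∉I = proj₁ (proj₂ y-marks)

          y~I : ∀ {i} → i ∈ I → i ≢ a → y ~ i
          y~I = proj₂ (proj₂ (proj₂ y-marks)) _

          y~S∩I : ∀ {p} → p ∈ I → p ∈ S → y ~ p
          y~S∩I p∈I p∈S = y~I p∈I (≢-by-∈ p∈S a∉S)

          -- `c` and `y` are adjacent; `y` would cover `A` and `S ∩ I`, while `c` covers `B` and
          -- `S ∖ I`.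
          no-dominator : ∀ {c} → c ∈ B → c ∉ I → (∀ {b} → b ∈ B → Covers c b) →
            ¬ (∀ {d} → d ∈ A → y ~ d)
          no-dominator {c} c∈B c∉I c-B y~A = no-covering-pair (inj₂ (~-sym (S∖I~B y∈S y∉I c∈B c∉I))) pair
            where
            pair : CoveringPair c y
            pair s with cover C s
            ... | inj₁ s∈A        = inj₂ (inj₂ (y~A s∈A))
            ... | inj₂ (inj₁ s∈B) = inj₁ (c-B s∈B)
            ... | inj₂ (inj₂ s∈S) with s ∈? I
            ...   | yes s∈I = inj₂ (inj₂ (y~S∩I s∈I s∈S))
            ...   | no  s∉I = inj₁ (inj₂ (~-sym (S∖I~B s∈S s∉I c∈B c∉I)))

          -- At least three vertices in `I ∖ S`: contradiction.

          module Third {a₂} (a₂∈I : a₂ ∈ I) (a₂∉S : a₂ ∉ S) (a₂≢x₀ : a₂ ≢ x₀) (a₂≢a : a₂ ≢ a) where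

            another : ∀ b → ∃[ b′ ] (b′ ∈ I × b′ ∉ S × b′ ≢ x₀ × b′ ≢ b)
            another b with b ≟ a
            ... | yes refl = a₂ , a₂∈I , a₂∉S , a₂≢x₀ , a₂≢a
            ... | no  b≢a  = a , a∈I , a∉S , a≢x₀ , ≢-sym b≢a

            -- Let `q` mark `b`, and apply `cross` to `d` and `b`. A covering pair misses `b′`. An
            -- arc from `b` to `d` through `r` fails at the vertex `h` marked by `r`. For an arc
            -- from `d` to `b` through `r`, covering `b′` forces `r ∉ I`, and then `r` must mark
            -- `b`; by `marker-unique`, `r` is `q`, so `d ~ q`.
            S∖I~A : ∀ {q} → q ∈ S → q ∉ I → ∀ {d} → d ∈ A → q ~ d
            S∖I~A {q} q∈S q∉I {d} d∈A with marked-by q∈S q∉I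
            ... | b , b∈I , b∉S , b≢x₀ , _ , m with another b
            ... | b′ , b′∈I , b′∉S , b′≢x₀ , b′≢b
              with cross C d∈A (I∖S⊆B b∈I b∉S b≢x₀)
            ... | inj₁ pair = contradiction (pair b′)
              [ A-B C d∈A (I∖S⊆B b′∈I b′∉S b′≢x₀) , I-uncovered b∈I b′∈I b′≢b ]
            ... | inj₂ (inj₂ (r , r∈S , arc)) with marked-by r∈S (λ r∈I → independent b∈I r∈I (Arc.u~y arc))
            ...   | h , h∈I , h∉S , h≢x₀ , x₀-arc , _ with h ≟ b
            ...     | yes refl = contradiction (~-sym (Arc.u~y arc)) (Arc.y≁v x₀-arc)
            ...     | no  h≢b  = contradiction
              (Arc.covers arc h (λ { refl → A∩B C d∈A (I∖S⊆B h∈I h∉S h≢x₀) }))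
              [ I-uncovered b∈I h∈I h≢b , covers-out (≢-sym (≢-by-∈ r∈S h∉S)) (Arc.y≁v x₀-arc) ]
            S∖I~A {q} q∈S q∉I {d} d∈A | b , b∈I , b∉S , b≢x₀ , _ , m | b′ , b′∈I , b′∉S , b′≢x₀ , b′≢b
              | inj₂ (inj₁ (r , r∈S , arc)) with marked-by r∈S r∉I
              where
              r∉I : r ∉ I
              r∉I r∈I = contradiction (Arc.covers arc b′ b′≢b)
                [ A-B C d∈A (I∖S⊆B b′∈I b′∉S b′≢x₀) , S∩I-misses r∈S r∈I b′∈I b′∉S ]
            ... | h , h∈I , h∉S , h≢x₀ , x₀-arc , mr with h ≟ b
            ...   | no h≢b = contradiction (Arc.covers arc h h≢b)
              [ A-B C d∈A (I∖S⊆B h∈I h∉S h≢x₀) , covers-out (≢-sym (≢-by-∈ r∈S h∉S)) (Arc.y≁v x₀-arc) ]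
            ...   | yes refl with marker-unique b∈I m mr
            ...     | refl = ~-sym (Arc.u~y arc)

            impossible : ⊥
            impossible = no-dominator c∈B c∉I c-B (S∖I~A y∈S y∉I)
              where
              c : Fin n
              c = proj₁ B∖I-member
              c∈B : c ∈ B
              c∈B = proj₁ (proj₂ B∖I-member)
              c∉I : c ∉ I
              c∉I = proj₂ (proj₂ B∖I-member)
              c-B : ∀ {b} → b ∈ B → Covers c b
              -- Every vertex of `S` is adjacent to `d`, which excludes an arc from `c` to `d`. An
              -- arc from `d` to `c` would have its middle in `S ∩ I` and leave `a` uncovered. So
              -- `d` and `c` dominate.
              c-B with A-second
              ... | d , d∈A , d≢x₀ with cross C d∈A c∈B
              ... | inj₁ pair = pair-covers-B C pair d∈A
              ... | inj₂ (inj₁ (q , q∈S , arc)) = contradiction (Arc.covers arc a (≢-by-∈ a∈I c∉I))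
                [ A-B C d∈A a∈B
                , S∩I-misses q∈S (decidable-stable (q ∈? I) λ q∉I → Arc.y≁v arc (S∖I~B q∈S q∉I c∈B c∉I)) a∈I a∉S ]
              ... | inj₂ (inj₂ (q , q∈S , arc)) with q ∈? I
              ...   | yes q∈I = contradiction (p~A q∈I q∈S d∈A d≢x₀) (Arc.y≁v arc)
              ...   | no  q∉I = contradiction (S∖I~A q∈S q∉I d∈A) (Arc.y≁v arc)

          -- Exactly two vertices in `I ∖ S`: the structure of the graph.

          module NoThird (no-third : ∀ {b} → b ∈ I → b ∉ S → b ≢ x₀ → b ≡ a) where

            S∖I-unique : ∀ {q} → q ∈ S → q ∉ I → q ≡ y
            S∖I-unique q∈S q∉I with marked-by q∈S q∉I
            ... | b , b∈I , b∉S , b≢x₀ , _ , m with no-third b∈I b∉S b≢x₀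
            ...   | refl = marker-unique a∈I y-marks m

            a≁S : ∀ {q} → q ∈ S → ¬ (a ~ q)
            a≁S {q} q∈S a~q with q ∈? I
            ... | yes q∈I = independent a∈I q∈I a~q
            ... | no  q∉I with S∖I-unique q∈S q∉I
            ...   | refl = Arc.y≁v y-arc (~-sym a~q)

            ~a⇒∈B : ∀ {z} → a ~ z → z ∈ B
            ~a⇒∈B {z} a~z with cover C z
            ... | inj₁ z∈A        = contradiction (~-sym a~z) (A≁B C z∈A a∈B)
            ... | inj₂ (inj₁ z∈B) = z∈B
            ... | inj₂ (inj₂ z∈S) = contradiction a~z (a≁S z∈S)

            -- The middle would be adjacent to both `x₀` and `a`. Since `a` has no neighbour in `S`,
            -- it would lie in `B`, which has no edge to `x₀ ∈ A`.
            S∩I-arcless : ∀ {p p′} → p ∈ S → p ∈ I → p′ ∈ S → ¬ (∃[ r ] Arc p p′ r)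
            S∩I-arcless {p} {p′} p∈S p∈I p′∈S (r , arc) = A≁B C x₀∈A (~a⇒∈B (~-sym (r~ a∈I a∉S))) (~-sym (r~ x₀∈I x₀∉S))
              where
              r~ : ∀ {i} → i ∈ I → i ∉ S → r ~ i
              r~ {i} i∈I i∉S with Arc.covers arc i (≢-sym (≢-by-∈ p′∈S i∉S))
              ... | inj₁ c           = contradiction c (S∩I-misses p∈S p∈I i∈I i∉S)
              ... | inj₂ (inj₁ refl) = contradiction (Arc.u~y arc) (independent p∈I i∈I)
              ... | inj₂ (inj₂ r~i)  = r~i

            S∩I-unique : ∀ {p p′} → p ∈ I → p ∈ S → p′ ∈ I → p′ ∈ S → p′ ≡ p
            S∩I-unique {p} {p′} p∈I p∈S p′∈I p′∈S with p′ ≟ p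
            ... | yes p′≡p = p′≡p
            ... | no  p′≢p with tournament p′∈I p∈I p′≢p
            ...   | inj₁ arc = ⊥-elim (S∩I-arcless p′∈S p′∈I p∈S arc)
            ...   | inj₂ arc = ⊥-elim (S∩I-arcless p∈S p∈I p′∈S arc)

            p-exists : ∃[ p ] (p ∈ I × p ∈ S)
            p-exists with third x₀ a
            ... | p , p∈I , p≢x₀ , p≢a = p , p∈I ,
              decidable-stable (p ∈? S) (λ p∉S → p≢a (no-third p∈I p∉S p≢x₀))

            p : Fin n
            p = proj₁ p-exists

            p∈I : p ∈ I
            p∈I = proj₁ (proj₂ p-exists)

            p∈S : p ∈ S
            p∈S = proj₂ (proj₂ p-exists)

            p≢y : p ≢ y
            p≢y = ≢-by-∈ p∈I y∉I

            S-cases : ∀ {q} → q ∈ S → q ≡ p ⊎ q ≡ y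
            S-cases {q} q∈S with q ∈? I
            ... | yes q∈I = inj₁ (S∩I-unique p∈I p∈S q∈I q∈S)
            ... | no  q∉I = inj₂ (S∖I-unique q∈S q∉I)

            x₀~y : x₀ ~ y
            x₀~y = Arc.u~y y-arc

            p≁x₀ : ¬ (p ~ x₀)
            p≁x₀ = independent p∈I x₀∈I

            x₀≢a : x₀ ≢ a
            x₀≢a = ≢-sym a≢x₀

            B-a∩I : ∀ {c} → c ∈ B → c ≢ a → c ∉ I
            B-a∩I c∈B c≢a c∈I = c≢a (no-third c∈I (B∩S C c∈B) λ { refl → A∩B C x₀∈A c∈B })

            y~B : ∀ {c} → c ∈ B → c ≢ a → y ~ c
            y~B c∈B c≢a = S∖I~B y∈S y∉I c∈B (B-a∩I c∈B c≢a)

            -- In `cross` for `x₀` and `c`, only a covering pair or an arc from `c` to `x₀` through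
            -- `p` survives; in both cases `c` is what covers `a`.
            a~B : ∀ {c} → c ∈ B → c ≢ a → a ~ c
            a~B {c} c∈B c≢a with cross C x₀∈A c∈B
            ... | inj₁ pair = case pair-covers-B C pair x₀∈A a∈B of λ
              { (inj₁ a≡c) → contradiction (sym a≡c) c≢a ; (inj₂ c~a) → ~-sym c~a }
            ... | inj₂ (inj₁ (q , q∈S , arc)) with S-cases q∈S
            ...   | inj₁ refl = contradiction (~-sym (Arc.u~y arc)) p≁x₀
            ...   | inj₂ refl = contradiction (y~B c∈B c≢a) (Arc.y≁v arc)
            a~B {c} c∈B c≢a | inj₂ (inj₂ (q , q∈S , arc)) with S-cases q∈S
            ...   | inj₂ refl = contradiction (~-sym x₀~y) (Arc.y≁v arc)
            ...   | inj₁ refl with Arc.covers arc a a≢x₀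
            ...     | inj₁ (inj₁ a≡c) = contradiction (sym a≡c) c≢a
            ...     | inj₁ (inj₂ c~a) = ~-sym c~a
            ...     | inj₂ cov        = contradiction cov (S∩I-misses p∈S p∈I a∈I a∉S)

            -- An arc from `d` to `c` through `y` contradicts `y~B`, and through `p` it leaves `a`
            -- uncovered. An arc from `c` to `d` through `p` contradicts `p~A`; only the one through
            -- `y` remains.
            cross-cases : ∀ {c d} → c ∈ B → c ≢ a → d ∈ A → d ≢ x₀ →
              CoveringPair d c ⊎ (¬ (y ~ d) × (∀ {s} → s ∈ A → s ≢ d → y ~ s))
            cross-cases {c} {d} c∈B c≢a d∈A d≢x₀ with cross C d∈A c∈B
            ... | inj₁ pair = inj₁ pair
            ... | inj₂ (inj₁ (q , q∈S , arc)) with S-cases q∈S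
            ...   | inj₂ refl = contradiction (y~B c∈B c≢a) (Arc.y≁v arc)
            ...   | inj₁ refl = contradiction (Arc.covers arc a (≢-sym c≢a))
              [ A-B C d∈A a∈B , S∩I-misses p∈S p∈I a∈I a∉S ]
            cross-cases {c} {d} c∈B c≢a d∈A d≢x₀ | inj₂ (inj₂ (q , q∈S , arc)) with S-cases q∈S
            ...   | inj₁ refl = contradiction (p~A p∈I p∈S d∈A d≢x₀) (Arc.y≁v arc)
            ...   | inj₂ refl = inj₂ (Arc.y≁v arc , y~A)
              where
              y~A : ∀ {s} → s ∈ A → s ≢ d → y ~ s
              y~A {s} s∈A s≢d with Arc.covers arc s s≢d
              ... | inj₁ cov         = contradiction cov (B-A C c∈B s∈A)
              ... | inj₂ (inj₁ refl) = contradiction y∈S (A∩S C s∈A)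
              ... | inj₂ (inj₂ y~s)  = y~s

            c : Fin n
            c = proj₁ B∖I-member

            c∈B : c ∈ B
            c∈B = proj₁ (proj₂ B∖I-member)

            c≢a : c ≢ a
            c≢a = ≢-sym (≢-by-∈ a∈I (proj₂ (proj₂ B∖I-member)))

            -- If `y` covered `A`, then `cross-cases` would give a covering pair, `c` would cover
            -- `B`, and `no-dominator` would apply.
            y-misses : ∃[ d ] (d ∈ A × ¬ (y ~ d))
            y-misses with any? (λ d → (d ∈? A) ×-dec ¬? (y ~? d))
            ... | yes found = found
            ... | no none = ⊥-elim (no-dominator c∈B (proj₂ (proj₂ B∖I-member)) c-B y~A)
              where
              y~A : ∀ {d} → d ∈ A → y ~ d
              y~A {d} d∈A = decidable-stable (y ~? d) (λ y≁d → none (d , d∈A , y≁d))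
              c-B : ∀ {b} → b ∈ B → Covers c b
              c-B with A-second
              ... | d , d∈A , d≢x₀ with cross-cases c∈B c≢a d∈A d≢x₀
              ...   | inj₁ pair      = pair-covers-B C pair d∈A
              ...   | inj₂ (y≁d , _) = contradiction (y~A d∈A) y≁d

            d₀ : Fin n
            d₀ = proj₁ y-misses

            d₀∈A : d₀ ∈ A
            d₀∈A = proj₁ (proj₂ y-misses)

            y≁d₀ : ¬ (y ~ d₀)
            y≁d₀ = proj₂ (proj₂ y-misses)

            d₀≢x₀ : d₀ ≢ x₀
            d₀≢x₀ d₀≡x₀ = y≁d₀ (subst (y ~_) (sym d₀≡x₀) (~-sym x₀~y))

            a-missed : ∀ {d} → d ∈ A → ¬ Covers d a
            a-missed d∈A = A-B C d∈A a∈B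

            y-a-missed : ¬ Covers y a
            y-a-missed = covers-out (≢-sym (≢-by-∈ y∈S a∉S)) (Arc.y≁v y-arc)

            -- Criticality is applied to `y` and `d₀`. As neither covers `a`, there is an arc whose
            -- middle covers `a` and so lies in `B`. It cannot start at `d₀ ∈ A`; in the arc from
            -- `y` to `d₀` the middle covers nothing in `A`, so `y` does.
            y~A : ∀ {d} → d ∈ A → d ≢ d₀ → y ~ d
            y~A {d} d∈A d≢d₀ with y ~? d
            ... | yes y~d = y~d
            ... | no  y≁d with trichotomy (≢-by-∈ y∈S (A∩S C d₀∈A)) y≁d₀
            ...   | inj₁ pair = contradiction (pair a) [ y-a-missed , a-missed d₀∈A ]
            ...   | inj₂ (inj₁ (z , arc)) = contradiction (Arc.covers arc d d≢d₀)
              [ covers-out (λ { refl → A∩S C d∈A y∈S }) y≁d , B-A C z∈B d∈A ]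
              where
              z∈B : z ∈ B
              z∈B with Arc.covers arc a (≢-by-∈ a∈B (A∩B C d₀∈A))
              ... | inj₁ cov         = contradiction cov y-a-missed
              ... | inj₂ (inj₁ refl) = a∈B
              ... | inj₂ (inj₂ z~a)  = ~a⇒∈B (~-sym z~a)
            ...   | inj₂ (inj₂ (z , arc)) = contradiction (Arc.u~y arc) (A≁B C d₀∈A z∈B)
              where
              z∈B : z ∈ B
              z∈B with Arc.covers arc a (≢-sym (≢-by-∈ y∈S a∉S))
              ... | inj₁ cov         = contradiction cov (a-missed d₀∈A)
              ... | inj₂ (inj₁ refl) = a∈B
              ... | inj₂ (inj₂ z~a)  = ~a⇒∈B (~-sym z~a)

            covering : ∀ {b d} → b ∈ B → b ≢ a → d ∈ A → d ≢ x₀ → d ≢ d₀ → CoveringPair d b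
            covering b∈B b≢a d∈A d≢x₀ d≢d₀ with cross-cases b∈B b≢a d∈A d≢x₀
            ... | inj₁ pair      = pair
            ... | inj₂ (y≁d , _) = contradiction (y~A d∈A d≢d₀) y≁d

            A-third : ∃[ d ] (d ∈ A × d ≢ x₀ × d ≢ d₀)
            -- The only neighbour of `x₀` in `S` is `y`, so a neighbour other than `y` and `d₀` lies
            -- in `A`.
            A-third with escape x₀ (⁅ y ⁆ ∪ ⁅ d₀ ⁆) (≤-trans (∣⁅x⁆∪⁅y⁆∣≤2 y d₀) 2≤∣S∣)
            ... | d , x₀~d , d∉ = d , d∈A , (λ { refl → ~-irrefl x₀~d }) , λ { refl → d∉ (y∈⁅x⁆∪⁅y⁆ y d₀) }
              where
              d∈A : d ∈ A
              d∈A with cover C d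
              ... | inj₁ d∈A        = d∈A
              ... | inj₂ (inj₁ d∈B) = contradiction x₀~d (A≁B C x₀∈A d∈B)
              ... | inj₂ (inj₂ d∈S) with S-cases d∈S
              ...   | inj₁ refl = contradiction (~-sym x₀~d) p≁x₀
              ...   | inj₂ refl = contradiction (x∈⁅x⁆∪⁅y⁆ y d₀) d∉

            -- The vertex from `A-third` forms a covering pair with `b`, so `b` alone covers `B`.
            B-clique : ∀ {b b′} → b ∈ B → b′ ∈ B → b ≢ a → b ≢ b′ → b ~ b′
            B-clique b∈B b′∈B b≢a b≢b′ with A-third
            ... | d , d∈A , d≢x₀ , d≢d₀ with pair-covers-B C (covering b∈B b≢a d∈A d≢x₀ d≢d₀) d∈A b′∈B
            ...   | inj₁ b′≡b = contradiction (sym b′≡b) b≢b′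
            ...   | inj₂ b~b′ = b~b′

            -- {d₀,a} leaves y uncovered and a has no neighbour in S, so criticality gives d₀ → a through p.
            d₀-arc : Arc d₀ a p
            d₀-arc with cross C d₀∈A a∈B
            ... | inj₁ pair = contradiction (pair y)
              [ covers-out (≢-by-∈ y∈S (A∩S C d₀∈A)) (y≁d₀ ∘ ~-sym)
              , covers-out (≢-by-∈ y∈S a∉S) (a≁S y∈S) ]
            ... | inj₂ (inj₂ (q , q∈S , arc)) = contradiction (Arc.u~y arc) (a≁S q∈S)
            ... | inj₂ (inj₁ (q , q∈S , arc)) with S-cases q∈S
            ...   | inj₁ refl = arc
            ...   | inj₂ refl = contradiction (~-sym (Arc.u~y arc)) y≁d₀

            d₀~x₀ : d₀ ~ x₀
            d₀~x₀ with Arc.covers d₀-arc x₀ x₀≢a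
            ... | inj₁ (inj₁ x₀≡d₀) = contradiction (sym x₀≡d₀) d₀≢x₀
            ... | inj₁ (inj₂ d₀~x₀) = d₀~x₀
            ... | inj₂ cov          = contradiction cov (S∩I-misses p∈S p∈I x₀∈I x₀∉S)

            p~B : ∀ {b} → b ∈ B → b ≢ a → p ~ b
            p~B {b} b∈B b≢a with Arc.covers d₀-arc b b≢a
            ... | inj₁ cov         = contradiction cov (A-B C d₀∈A b∈B)
            ... | inj₂ (inj₁ refl) = contradiction p∈S (B∩S C b∈B)
            ... | inj₂ (inj₂ p~b)  = p~b

            A-dominated : ∀ {d d′} → d ∈ A → d′ ∈ A → d ≢ x₀ → d ≢ d₀ → d ≢ d′ → d ~ d′
            A-dominated d∈A d′∈A d≢x₀ d≢d₀ d≢d′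
              with pair-covers-A C (covering c∈B c≢a d∈A d≢x₀ d≢d₀) c∈B d′∈A
            ... | inj₁ d′≡d = contradiction (sym d′≡d) d≢d′
            ... | inj₂ d~d′ = d~d′

            -- `A-dominated` handles every pair except `x₀` and `d₀`, whose edge comes from
            -- `d₀-arc`.
            A-clique : ∀ {d d′} → d ∈ A → d′ ∈ A → d ≢ d′ → d ~ d′
            A-clique {d} {d′} d∈A d′∈A d≢d′ with d ≟ x₀ | d ≟ d₀ | d′ ≟ x₀ | d′ ≟ d₀
            ... | no d≢x₀  | no d≢d₀  | _         | _         = A-dominated d∈A d′∈A d≢x₀ d≢d₀ d≢d′
            ... | _        | _        | no d′≢x₀  | no d′≢d₀  =
              ~-sym (A-dominated d′∈A d∈A d′≢x₀ d′≢d₀ (≢-sym d≢d′))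
            ... | yes refl | _        | yes refl  | _         = contradiction refl d≢d′
            ... | yes refl | _        | no _      | yes refl  = ~-sym d₀~x₀
            ... | no _     | yes refl | yes refl  | _         = d₀~x₀
            ... | no _     | yes refl | no _      | yes refl  = contradiction refl d≢d′

            3≤∣A∣ : 3 ≤ ∣ A ∣
            3≤∣A∣ with 3 ≤? ∣ A ∣
            ... | yes 3≤∣A∣ = 3≤∣A∣
            ... | no  3≰∣A∣ with ∣p∣≤2⇒pair (≤-pred (≰⇒> 3≰∣A∣)) x₀∈A | A-third
            ...   | s , _ , only | d , d∈A , d≢x₀ , d≢d₀ with only d∈A | only d₀∈A
            ...     | inj₁ d≡x₀ | _          = contradiction d≡x₀ d≢x₀
            ...     | inj₂ _    | inj₁ d₀≡x₀ = contradiction d₀≡x₀ d₀≢x₀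
            ...     | inj₂ refl | inj₂ d₀≡d  = contradiction (sym d₀≡d) d≢d₀

            3≤∣B-a∣ : 3 ≤ ∣ B - a ∣
            3≤∣B-a∣ with 3 ≤? ∣ B - a ∣
            ... | yes 3≤∣B-a∣ = 3≤∣B-a∣
            -- All neighbours of `a` lie in `B - a`, and there are more than |S| ≥ 2 of them.
            ... | no  3≰∣B-a∣ with escape a (B - a) (≤-trans (≤-pred (≰⇒> 3≰∣B-a∣)) 2≤∣S∣)
            ...   | z , a~z , z∉B-a = contradiction
              (x∈p∧x≢y⇒x∈p-y (~a⇒∈B a~z) (λ { refl → ~-irrefl a~z })) z∉B-a

            exceptional : Exceptional _~_
            exceptional = record
              { J₁ᵛ = B - a ; J₂ᵛ = A ; v = a ; ω = y ; ω₁ = p ; u₁ = x₀ ; u₂ = d₀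
              ; partition = partition
              ; J₁∩J₂ = λ s∈B-a s∈A → A∩B C s∈A (⇒∈B s∈B-a)
              ; v∉J₁  = λ a∈B-a → ⇒≢a a∈B-a refl
              ; v∉J₂  = λ a∈A → A∩B C a∈A a∈B
              ; ω₁∉J₁ = λ p∈B-a → B∩S C (⇒∈B p∈B-a) p∈S
              ; ω₁∉J₂ = λ p∈A → A∩S C p∈A p∈S
              ; ω∉J₁  = λ y∈B-a → B∩S C (⇒∈B y∈B-a) y∈S
              ; ω∉J₂  = λ y∈A → A∩S C y∈A y∈S
              ; v≢ω₁  = ≢-sym (≢-by-∈ p∈S a∉S)
              ; v≢ω   = ≢-sym (≢-by-∈ y∈S a∉S)
              ; ω₁≢ω  = p≢y
              ; 3≤∣J₁∣ = 3≤∣B-a∣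
              ; 3≤∣J₂∣ = 3≤∣A∣
              ; u₁∈J₂ = x₀∈A
              ; u₂∈J₂ = d₀∈A
              ; u₁≢u₂ = ≢-sym d₀≢x₀
              ; J₁-clique = λ b b′ b≢b′ → B-clique (⇒∈B b) (⇒∈B b′) (⇒≢a b) b≢b′
              ; J₂-clique = A-clique
              ; J₁≁J₂ = λ b d b~d → A≁B C d (⇒∈B b) (~-sym b~d)
              ; v~J₁  = λ b → a~B (⇒∈B b) (⇒≢a b)
              ; v≁J₂  = λ d a~d → A≁B C d a∈B (~-sym a~d)
              ; v≁ω₁  = a≁S p∈S
              ; v≁ω   = a≁S y∈S
              ; ω₁~ω  = ~-sym (y~S∩I p∈I p∈S)
              ; ω₁~J₁ = λ b → p~B (⇒∈B b) (⇒≢a b)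
              ; ω~J₁  = λ b → y~B (⇒∈B b) (⇒≢a b)
              ; ω₁~J₂ = p~A p∈I p∈S
              ; ω₁≁u₁ = p≁x₀
              ; ω~J₂  = y~A
              ; ω≁u₂  = y≁d₀
              }
              where
              ⇒∈B : ∀ {s} → s ∈ B - a → s ∈ B
              ⇒∈B = proj₁ ∘ x∈p-y⁻ B a
              ⇒≢a : ∀ {s} → s ∈ B - a → s ≢ a
              ⇒≢a = proj₂ ∘ x∈p-y⁻ B a
              partition : ∀ s → s ∈ B - a ⊎ s ∈ A ⊎ s ≡ a ⊎ s ≡ p ⊎ s ≡ y
              partition s with cover C s
              ... | inj₁ s∈A        = inj₂ (inj₁ s∈A)
              ... | inj₂ (inj₂ s∈S) = inj₂ (inj₂ (inj₂ (S-cases s∈S)))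
              ... | inj₂ (inj₁ s∈B) with s ≟ a
              ...   | yes s≡a = inj₂ (inj₂ (inj₁ s≡a))
              ...   | no  s≢a = inj₁ (x∈p∧x≢y⇒x∈p-y s∈B s≢a)

        cut⇒exceptional : Exceptional _~_
        cut⇒exceptional with any? (λ a → (a ∈? I) ×-dec (¬? (a ∈? S) ×-dec ¬? (a ≟ x₀)))
        ... | no none = ⊥-elim (I∖S-has-second λ a∈I a∉S a≢x₀ → none (_ , a∈I , a∉S , a≢x₀))
        ... | yes (a , a∈I , a∉S , a≢x₀)
          with any? (λ b → (b ∈? I) ×-dec (¬? (b ∈? S) ×-dec (¬? (b ≟ x₀) ×-dec ¬? (b ≟ a))))
        ...   | yes (b , b∈I , b∉S , b≢x₀ , b≢a) =
          ⊥-elim (Second.Third.impossible a∈I a∉S a≢x₀ b∈I b∉S b≢x₀ b≢a)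
        ...   | no none = Second.NoThird.exceptional a∈I a∉S a≢x₀ λ {b} b∈I b∉S b≢x₀ →
          decidable-stable (b ≟ a) (λ b≢a → none (b , b∈I , b∉S , b≢x₀ , b≢a))

      large-cut⇒exceptional : ∀ {A B} → Cut S A B → Exceptional _~_
      large-cut⇒exceptional C with unmarked
      ... | x , x∈I , x∉S , none with cover C x
      ...   | inj₁ x∈A        = Unmarked.cut⇒exceptional C x∈I x∈A none
      ...   | inj₂ (inj₁ x∈B) = Unmarked.cut⇒exceptional (swap-cut C) x∈I x∈B none
      ...   | inj₂ (inj₂ x∈S) = contradiction x∈S x∉S

-- The isomorphism with a member of the family.

module _ {n : ℕ} {_~_ : Fin n → Fin n → Set} (~-sym : ∀ {x y} → x ~ y → y ~ x)
  (~-irrefl : ∀ {x} → ¬ (x ~ x)) (X : Exceptional _~_) where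
  open Exceptional X

  private
    j₁ j₂ : ℕ
    j₁ = ∣ J₁ᵛ ∣
    j₂ = ∣ J₂ᵛ ∣

    i₁ i₂ : Fin j₂
    i₁ = proj₁ (element-surjective u₁∈J₂)
    i₂ = proj₁ (element-surjective u₂∈J₂)

    i₁-element : element J₂ᵛ i₁ ≡ u₁
    i₁-element = proj₂ (element-surjective u₁∈J₂)

    i₂-element : element J₂ᵛ i₂ ≡ u₂
    i₂-element = proj₂ (element-surjective u₂∈J₂)

    vertex : V233 j₁ j₂ → Fin n
    vertex (J₁ i) = element J₁ᵛ i
    vertex (J₂ i) = element J₂ᵛ i
    vertex w      = ω
    vertex w₁     = ω₁
    vertex v₁     = v

    J₁∋ : ∀ i → element J₁ᵛ i ∈ J₁ᵛ
    J₁∋ = element∈ J₁ᵛ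

    J₂∋ : ∀ i → element J₂ᵛ i ∈ J₂ᵛ
    J₂∋ = element∈ J₂ᵛ

    vertex-surjective : ∀ s → ∃[ t ] vertex t ≡ s
    vertex-surjective s with partition s
    ... | inj₁ s∈J₁                      = let i , eq = element-surjective s∈J₁ in J₁ i , eq
    ... | inj₂ (inj₁ s∈J₂)               = let i , eq = element-surjective s∈J₂ in J₂ i , eq
    ... | inj₂ (inj₂ (inj₁ s≡v))         = v₁ , sym s≡v
    ... | inj₂ (inj₂ (inj₂ (inj₁ s≡ω₁))) = w₁ , sym s≡ω₁
    ... | inj₂ (inj₂ (inj₂ (inj₂ s≡ω)))  = w , sym s≡ω

    vertex-injective : ∀ s t → vertex s ≡ vertex t → s ≡ t
    vertex-injective (J₁ i) (J₁ j) eq = cong J₁ (element-injective J₁ᵛ eq)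
    vertex-injective (J₁ i) (J₂ j) eq = contradiction (J₂∋ j) (J₁∩J₂ (subst (_∈ J₁ᵛ) eq (J₁∋ i)))
    vertex-injective (J₁ i) w      eq = contradiction eq (≢-by-∈ (J₁∋ i) ω∉J₁)
    vertex-injective (J₁ i) w₁     eq = contradiction eq (≢-by-∈ (J₁∋ i) ω₁∉J₁)
    vertex-injective (J₁ i) v₁     eq = contradiction eq (≢-by-∈ (J₁∋ i) v∉J₁)
    vertex-injective (J₂ i) (J₂ j) eq = cong J₂ (element-injective J₂ᵛ eq)
    vertex-injective (J₂ i) w      eq = contradiction eq (≢-by-∈ (J₂∋ i) ω∉J₂)
    vertex-injective (J₂ i) w₁     eq = contradiction eq (≢-by-∈ (J₂∋ i) ω₁∉J₂)
    vertex-injective (J₂ i) v₁     eq = contradiction eq (≢-by-∈ (J₂∋ i) v∉J₂)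
    vertex-injective w      w      eq = refl
    vertex-injective w      w₁     eq = contradiction (sym eq) ω₁≢ω
    vertex-injective w      v₁     eq = contradiction (sym eq) v≢ω
    vertex-injective w₁     w₁     eq = refl
    vertex-injective w₁     v₁     eq = contradiction (sym eq) v≢ω₁
    vertex-injective v₁     v₁     eq = refl
    vertex-injective (J₂ i) (J₁ j) eq = sym (vertex-injective (J₁ j) (J₂ i) (sym eq))
    vertex-injective w      (J₁ j) eq = sym (vertex-injective (J₁ j) w (sym eq))
    vertex-injective w      (J₂ j) eq = sym (vertex-injective (J₂ j) w (sym eq))
    vertex-injective w₁     (J₁ j) eq = sym (vertex-injective (J₁ j) w₁ (sym eq))
    vertex-injective w₁     (J₂ j) eq = sym (vertex-injective (J₂ j) w₁ (sym eq))
    vertex-injective w₁     w      eq = sym (vertex-injective w w₁ (sym eq))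
    vertex-injective v₁     (J₁ j) eq = sym (vertex-injective (J₁ j) v₁ (sym eq))
    vertex-injective v₁     (J₂ j) eq = sym (vertex-injective (J₂ j) v₁ (sym eq))
    vertex-injective v₁     w      eq = sym (vertex-injective w v₁ (sym eq))
    vertex-injective v₁     w₁     eq = sym (vertex-injective w₁ v₁ (sym eq))

    φ : Fin n ↔ V233 j₁ j₂
    φ = mk↔ₛ′ (proj₁ ∘ vertex-surjective) vertex
      (λ t → vertex-injective _ t (proj₂ (vertex-surjective (vertex t))))
      (proj₂ ∘ vertex-surjective)

    always : ∀ {P : Set} → P → P ⇔ ⊤
    always p = mk⇔ (λ _ → tt) (λ _ → p)

    never : ∀ {P : Set} → ¬ P → P ⇔ ⊥
    never ¬p = mk⇔ ¬p ⊥-elim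

    flip-⇔ : ∀ {x y} {P : Set} → (x ~ y) ⇔ P → (y ~ x) ⇔ P
    flip-⇔ e = mk⇔ (Equivalence.to e ∘ ~-sym) (~-sym ∘ Equivalence.from e)

    distinct-⇔ : ∀ {p : Subset n} (clique : ∀ {x y} → x ∈ p → y ∈ p → x ≢ y → x ~ y) i j →
      (element p i ~ element p j) ⇔ (i ≢ j)
    distinct-⇔ {p} clique i j = mk⇔ (λ { i~j refl → ~-irrefl i~j })
      (λ i≢j → clique (element∈ p i) (element∈ p j) (i≢j ∘ element-injective p))

    except-⇔ : ∀ {x u k} → element J₂ᵛ k ≡ u → (∀ {y} → y ∈ J₂ᵛ → y ≢ u → x ~ y) → ¬ (x ~ u) →
      ∀ i → (x ~ element J₂ᵛ i) ⇔ (i ≢ k)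
    except-⇔ refl x~ x≁u i = mk⇔ (λ { x~i refl → x≁u x~i })
      (λ i≢k → x~ (J₂∋ i) (i≢k ∘ element-injective J₂ᵛ))

    adjacency : ∀ s t → (vertex s ~ vertex t) ⇔ E233 i₁ i₂ s t
    adjacency (J₁ i) (J₁ j) = distinct-⇔ J₁-clique i j
    adjacency (J₂ i) (J₂ j) = distinct-⇔ J₂-clique i j
    adjacency (J₁ i) (J₂ j) = never (J₁≁J₂ (J₁∋ i) (J₂∋ j))
    adjacency (J₂ i) (J₁ j) = never (J₁≁J₂ (J₁∋ j) (J₂∋ i) ∘ ~-sym)
    adjacency v₁     (J₁ j) = always (v~J₁ (J₁∋ j))
    adjacency w₁     (J₁ j) = always (ω₁~J₁ (J₁∋ j))
    adjacency w      (J₁ j) = always (ω~J₁ (J₁∋ j))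
    adjacency v₁     (J₂ j) = never (v≁J₂ (J₂∋ j))
    adjacency w₁     (J₂ j) = except-⇔ i₁-element ω₁~J₂ ω₁≁u₁ j
    adjacency w      (J₂ j) = except-⇔ i₂-element ω~J₂ ω≁u₂ j
    adjacency w₁     w      = always ω₁~ω
    adjacency v₁     w₁     = never v≁ω₁
    adjacency v₁     w      = never v≁ω
    adjacency v₁     v₁     = never ~-irrefl
    adjacency w₁     w₁     = never ~-irrefl
    adjacency w      w      = never ~-irrefl
    adjacency (J₁ i) v₁     = flip-⇔ (adjacency v₁ (J₁ i))
    adjacency (J₁ i) w₁     = flip-⇔ (adjacency w₁ (J₁ i))
    adjacency (J₁ i) w      = flip-⇔ (adjacency w (J₁ i))
    adjacency (J₂ i) v₁     = flip-⇔ (adjacency v₁ (J₂ i))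
    adjacency (J₂ i) w₁     = flip-⇔ (adjacency w₁ (J₂ i))
    adjacency (J₂ i) w      = flip-⇔ (adjacency w (J₂ i))
    adjacency w      w₁     = flip-⇔ (adjacency w₁ w)
    adjacency w₁     v₁     = flip-⇔ (adjacency v₁ w₁)
    adjacency w      v₁     = flip-⇔ (adjacency v₁ w)

    adjacency-φ : ∀ x y → (x ~ y) ⇔ E233 i₁ i₂ (Inverse.to φ x) (Inverse.to φ y)
    adjacency-φ x y = subst₂ (λ a b → (a ~ b) ⇔ E233 i₁ i₂ (Inverse.to φ x) (Inverse.to φ y))
      (proj₂ (vertex-surjective x)) (proj₂ (vertex-surjective y))
      (adjacency (Inverse.to φ x) (Inverse.to φ y))

  exceptional⇒family : ∃[ j₁ ] ∃[ j₂ ] Σ[ u₁ ∈ Fin j₂ ] Σ[ u₂ ∈ Fin j₂ ]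
    (3 ≤ j₁ × 3 ≤ j₂ × u₁ ≢ u₂ × Σ[ φ ∈ (Fin n ↔ V233 j₁ j₂) ]
      (∀ x y → (x ~ y) ⇔ E233 u₁ u₂ (Inverse.to φ x) (Inverse.to φ y)))
  exceptional⇒family = j₁ , j₂ , i₁ , i₂ , 3≤∣J₁∣ , 3≤∣J₂∣
    , (λ i₁≡i₂ → u₁≢u₂ (trans (sym i₁-element) (trans (cong (element J₂ᵛ) i₁≡i₂) i₂-element)))
    , φ , adjacency-φ

-- From separating sets of the graph to cuts.

module FromGraph (G : Graph) (connected : Connected (Graph.adj G)) (crit : Critical3 (Graph.adj G)) where
  open Graph G using (n; adj) renaming (sym to adj-sym)

  _~_ : Fin n → Fin n → Set
  _~_ = Adj adj

  _~?_ : ∀ x y → Dec (x ~ y)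
  x ~? y = T? (adj x y)

  ~-sym : ∀ {x y} → x ~ y → y ~ x
  ~-sym = Adj-sym adj adj-sym

  ~-irrefl : ∀ {x} → ¬ (x ~ x)
  ~-irrefl {x} = subst T (Graph.irrefl G x)

  open Covering _~_
  open CriticalGraph _~_ _~?_ ~-sym ~-irrefl
    (no-covering-pair adj adj-sym crit) (trichotomy adj adj-sym crit)

  ∈-neighbourhood⁻ : ∀ {x y} → y ∈ neighbourhood adj x → x ~ y
  ∈-neighbourhood⁻ {x} {y} y∈ = Equivalence.from T-≡
    (trans (sym (lookup∘tabulate (adj x) y)) ([]=⇒lookup y∈))

  ∈-neighbourhood⁺ : ∀ {x y} → x ~ y → y ∈ neighbourhood adj x
  ∈-neighbourhood⁺ {x} {y} x~y = lookup⇒[]= y _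
    (trans (lookup∘tabulate (adj x) y) (Equivalence.to T-≡ x~y))

  -- No vertex dominates alone, so some `y` lies outside the closed neighbourhood of `x`. Hence κ ≤
  -- δ, and separating sets exist.
  neighbourhood-separating : ∀ x → Separating adj (neighbourhood adj x)
  neighbourhood-separating x
    with ¬∀⟶∃¬ n _ (covers? x) (λ all → no-covering-pair adj adj-sym crit {x} (inj₁ refl) (inj₁ ∘ all))
  ... | y , uncovered = x , y , (λ x∈ → ~-irrefl (∈-neighbourhood⁻ x∈))
      , (λ y∈ → uncovered (inj₂ (∈-neighbourhood⁻ y∈))) , no-path
    where
    head∉ : ∀ {p a b} → PathIn adj (∁ p) a b → a ∉ p
    head∉ (stop a∈)     = x∈∁p⇒x∉p a∈
    head∉ (step a∈ _ _) = x∈∁p⇒x∉p a∈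
    no-path : ¬ PathIn adj (∁ (neighbourhood adj x)) x y
    no-path (stop _)          = uncovered (inj₁ refl)
    no-path (step _ x~s path) = head∉ path (∈-neighbourhood⁺ x~s)

  module _ {S : Subset n} where

    -- A decidable certificate of separation: a set closed under adjacency outside `S`, in place of
    -- the component of `y`.
    Side : Fin n → Fin n → Subset n → Set
    Side x y A = y ∈ A × x ∉ A × (∀ s → s ∈ A → s ∉ S)
      × (∀ s t → s ∈ A → t ∉ S → s ~ t → t ∈ A)

    side? : ∀ x y A → Dec (Side x y A)
    side? x y A = (y ∈? A) ×-dec (¬? (x ∈? A) ×-dec
      (all? (λ s → (s ∈? A) →-dec ¬? (s ∈? S)) ×-dec
       all? (λ s → all? (λ t → (s ∈? A) →-dec (¬? (t ∈? S) →-dec ((s ~? t) →-dec (t ∈? A)))))))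

    -- Reachability is not evidently decidable, but Side is, so its double negation suffices.
    side : ∀ {x y} → y ∉ S → ¬ PathIn adj (∁ S) x y → ∃[ A ] Side x y A
    side {x} {y} y∉S no-path = decidable-stable (anySubset? (side? x y)) λ none →
      ¬¬-dec-Fin (λ s → PathIn adj (∁ S) s y) λ reach? → none (reachable reach?)
      where
      head∉ : ∀ {a b} → PathIn adj (∁ S) a b → a ∉ S
      head∉ (stop a∈)     = x∈∁p⇒x∉p a∈
      head∉ (step a∈ _ _) = x∈∁p⇒x∉p a∈
      reachable : (∀ s → Dec (PathIn adj (∁ S) s y)) → ∃[ A ] Side x y A
      reachable reach? = A , path⇒∈ (stop (x∉p⇒x∈∁p y∉S)) , no-path ∘ ∈⇒path
        , (λ s s∈A → head∉ (∈⇒path s∈A))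
        , (λ s t s∈A t∉S s~t → path⇒∈ (step (x∉p⇒x∈∁p t∉S) (~-sym s~t) (∈⇒path s∈A)))
        where
        A : Subset n
        A = tabulate (does ∘ reach?)
        path⇒∈ : ∀ {s} → PathIn adj (∁ S) s y → s ∈ A
        path⇒∈ {s} path = lookup⇒[]= s A (trans (lookup∘tabulate _ s) (dec-true (reach? s) path))
        ∈⇒path : ∀ {s} → s ∈ A → PathIn adj (∁ S) s y
        ∈⇒path {s} s∈A with reach? s | trans (sym (lookup∘tabulate (does ∘ reach?) s)) ([]=⇒lookup s∈A)
        ... | yes path | _ = path

  separating⇒cut : ∀ {S} → Separating adj S → ∃[ A ] ∃[ B ] Cut S A B
  separating⇒cut {S} (x , y , x∉S , y∉S , no-path) with side y∉S no-path
  ... | A , y∈A , x∉A , A∩S , closed = A , ∁ (A ∪ S) , record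
    { cover    = cover
    ; A∩B      = λ s∈A s∈B → x∈∁p⇒x∉p s∈B (x∈p∪q⁺ (inj₁ s∈A))
    ; A∩S      = A∩S _
    ; B∩S      = λ s∈B s∈S → x∈∁p⇒x∉p s∈B (x∈p∪q⁺ {p = A} (inj₂ s∈S))
    ; A≁B      = λ s∈A t∈B s~t → x∈∁p⇒x∉p t∈B
      (x∈p∪q⁺ (inj₁ (closed _ _ s∈A (λ t∈S → x∈∁p⇒x∉p t∈B (x∈p∪q⁺ {p = A} (inj₂ t∈S))) s~t)))
    ; A-member = y , y∈A
    ; B-member = x , x∉p⇒x∈∁p ([ x∉A , x∉S ] ∘ x∈p∪q⁻ A S)
    }
    where
    cover : ∀ s → s ∈ A ⊎ s ∈ ∁ (A ∪ S) ⊎ s ∈ S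
    cover s with s ∈? A | s ∈? S
    ... | yes s∈A | _       = inj₁ s∈A
    ... | no  _   | yes s∈S = inj₂ (inj₂ s∈S)
    ... | no  s∉A | no  s∉S = inj₂ (inj₁ (x∉p⇒x∈∁p ([ s∉A , s∉S ] ∘ x∈p∪q⁻ A S)))

  closed⇒full : ∀ (Q : Subset n) → (∀ {x y} → x ∈ Q → x ~ y → y ∈ Q) → ∀ {x y} → x ∈ Q → y ∈ Q
  closed⇒full Q closed {x} {y} x∈Q = along (connected x y ∈⊤ ∈⊤) x∈Q
    where
    along : ∀ {a b} → PathIn adj Full a b → a ∈ Q → b ∈ Q
    along (stop _)          a∈Q = a∈Q
    along (step _ a~s path) a∈Q = along path (closed a∈Q a~s)

  cut⇒family : ∀ {S I} → Separating adj S → (∀ x → ∣ S ∣ < degree adj x) →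
    Independent adj I → ∣ S ∣ < ∣ I ∣ → InG233 G
  cut⇒family {S} {I} separating ∣S∣<degree independent ∣S∣<∣I∣ = from-cut (separating⇒cut separating)
    where
    escape : ∀ x (Q : Subset n) → ∣ Q ∣ ≤ ∣ S ∣ → ∃[ y ] (x ~ y × y ∉ Q)
    escape x Q ∣Q∣≤∣S∣ with ∣p∣<∣q∣⇒∃∈q∉p Q (neighbourhood adj x) (≤-<-trans ∣Q∣≤∣S∣ (∣S∣<degree x))
    ... | y , y∈ , y∉Q = y , ∈-neighbourhood⁻ y∈ , y∉Q
    open WithSet S escape
    from-cut : ∃[ A ] ∃[ B ] Cut S A B → InG233 G
    from-cut (_ , _ , C) with 2 ≤? ∣ S ∣
    ... | no  2≰∣S∣ = ⊥-elim (SmallCut.no-small-cut (≤-pred (≰⇒> 2≰∣S∣)) closed⇒full C)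
    ... | yes 2≤∣S∣ = exceptional⇒family ~-sym ~-irrefl
      (LargeCut.large-cut⇒exceptional 2≤∣S∣ I (independent _ _) ∣S∣<∣I∣ C)

theorem3p7 : (G : Graph) → Connected (Graph.adj G) → Critical3 (Graph.adj G) →
    (κ α δ : ℕ) → ConnectivityNum (Graph.adj G) κ → IndepNum (Graph.adj G) α →
    MinDeg (Graph.adj G) δ → suc κ ≤ α → InG233 G ⊎ κ ≡ δ
theorem3p7 G connected crit κ α δ (inj₂ (none , _)) _ ((x , _) , _) _ =
  -- The convention for complete graphs never applies, since neighbourhoods separate.
  contradiction (FromGraph.neighbourhood-separating G connected crit x) (none _)
theorem3p7 G connected crit κ α δ (inj₁ ((S , separating , refl) , minimum)) ((I , independent , refl) , _)
  ((x , refl) , δ≤degree) κ<α with ∣ S ∣ ℕ.≟ degree (Graph.adj G) x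
... | yes κ≡δ = inj₂ κ≡δ
... | no  κ≢δ = inj₁ (FromGraph.cut⇒family G connected crit separating
  (λ y → <-≤-trans κ<δ (δ≤degree y)) independent κ<α)
  where
  κ<δ : ∣ S ∣ < degree (Graph.adj G) x
  -- Minimality of the cut against the neighbourhood of a vertex of minimum degree gives κ ≤ δ.
  κ<δ = ≤∧≢⇒< (minimum _ (FromGraph.neighbourhood-separating G connected crit x)) κ≢δ
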